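{- Let $\Lambda$ be a complete extended metric space with a monoid structure $(\Lambda,*,0)$ such that $d_\Lambda(\alpha*\beta,\alpha'*\beta')\le d_\Lambda(\alpha,\alpha')+d_\Lambda(\beta,\beta')$ for all $\alpha,\alpha',\beta,\beta'\in\Lambda$, and let $\mathcal{W}$ be the quantitative theory of writing computations of type $\Lambda$. The monads $\mathbb{C}T_{\mathcal{W}}$ and $(\Lambda\,\square\,-)$ on $\mathbf{CMet}$ are isomorphic.
   Context: An extended metric space is a set $X$ with $d_X:X\times X\to[0,\infty]$ satisfying $d_X(x,y)=0$ iff $x=y$, symmetry and the triangle inequality. $\mathbf{Met}$ is the category of extended metric spaces and non-expansive maps; $\mathbf{CMet}$ is its full subcategory of (Cauchy) complete spaces. Quantitative theories. A signature $\Sigma$ is a set of function symbols $f:n$ of finite arity $n\in\mathbb{N}$. Fix a countably infinite set of variables $V$; terms are $\Sigma$-terms over $V$. A quantitative equation is an expression $t=_\varepsilon s$ with $t,s$ terms and $\varepsilon\in\mathbb{Q}_{\ge0}$. A conditional quantitative equation is $\Gamma\vdash t=_\varepsilon s$ with $\Gamma$ a finite set of quantitative equations. A quantitative equational theory of type $\Sigma$ is a set $\mathcal{U}$ of conditional quantitative equations containing (for all variables and rationals $\varepsilon,\varepsilon'\ge 0$) $\vdash x=_0x$; $\{x=_\varepsilon y\}\vdash y=_\varepsilon x$; $\{x=_\varepsilon z,z=_{\varepsilon'}y\}\vdash x=_{\varepsilon+\varepsilon'}y$; $\{x=_\varepsilon y\}\vdash x=_{\varepsilon+\varepsilon'}y$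 for $\varepsilon'>0$; $\{x_i=_\varepsilon y_i\mid i=1,\dots,n\}\vdash f(x_1,\dots,x_n)=_\varepsilon f(y_1,\dots,y_n)$ for $f:n\in\Sigma$; and closed under: continuity (if $\Gamma\vdash t=_{\varepsilon'}s\in\mathcal{U}$ for all $\varepsilon'>\varepsilon$ then $\Gamma\vdash t=_\varepsilon s\in\mathcal{U}$), substitution of terms for variables, assumption ($\Gamma\vdash\phi\in\mathcal{U}$ whenever $\phi\in\Gamma$), and cut (if $\Gamma\vdash\phi\in\mathcal{U}$ for all $\phi\in\Theta$ and $\Theta\vdash\psi\in\mathcal{U}$ then $\Gamma\vdash\psi\in\mathcal{U}$). A set $A$ of conditional quantitative equations axiomatizes $\mathcal{U}$ if $\mathcal{U}$ is the smallest theory containing $A$. Models. A quantitative $\Sigma$-algebra is an extended metric space $A$ with, for each $f:n\in\Sigma$, a map $f^A:A^n\to A$ that is non-expansive for the max metric on $A^n$. It satisfies $\Gamma\vdash t=_\varepsilon s$ if for every assignment $\iota:V\to A$ (extended homomorphically to terms), $d_A(\iota(t'),\iota(s'))\le\varepsilon'$ for all $t'=_{\varepsilon'}s'\in\Gamma$ implies $d_A(\iota(t),\iota(s))\le\varepsilon$. $\mathbb{C}\mathbb{K}(\Sigma,\mathcal{U})$ is the category of quantitative $\Sigma$-algebras with complete carrier satisfying all members of $\mathcal{U}$, with non-expansive $\Sigma$-homomorphisms. For the theory $\mathcal{U}=\mathcal{W}$ below (and more generally for "continuous" theories) the forgetful functor $\mathbb{C}\mathbb{K}(\Sigma,\mathcal{U})\to\mathbf{CMet}$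 has a left adjoint (known), sending $X$ to the Cauchy completion of the free quantitative algebra on $X$ satisfying $\mathcal{U}$; the induced monad on $\mathbf{CMet}$ is denoted $\mathbb{C}T_{\mathcal{U}}$. Writer theory. $\mathcal{W}$ has signature $\{\mathsf{w}_\alpha:1\mid\alpha\in\Lambda\}$ and is axiomatized by, for all $\alpha,\alpha'\in\Lambda$: $\vdash x=_0\mathsf{w}_0(x)$; $\ \vdash\mathsf{w}_\alpha(\mathsf{w}_{\alpha'}(x))=_0\mathsf{w}_{\alpha*\alpha'}(x)$; $\ \{x=_\varepsilon x'\}\vdash\mathsf{w}_\alpha(x)=_\delta\mathsf{w}_{\alpha'}(x')$ for all $\varepsilon,\delta\in\mathbb{Q}_{\ge0}$ with $\delta\ge d_\Lambda(\alpha,\alpha')+\varepsilon$. Writer monad. $X\square Y$ is $X\times Y$ with $d((x,y),(x',y'))=d_X(x,x')+d_Y(y,y')$. The functor $\Lambda\square-$ acts on morphisms by $(\alpha,x)\mapsto(\alpha,f(x))$; unit $\tau_X(x)=(0,x)$; multiplication $\varsigma_X(\alpha,(\alpha',x))=(\alpha*\alpha',x)$. -}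

module Defs where

open import Level using (Level; _⊔_; 0ℓ; Lift; lift; lower)
open import Data.Nat as ℕ using (ℕ)
import Data.Nat.Properties as ℕ
import Data.Nat.Coprimality as Coprime
open import Data.Integer as ℤ using (ℤ)
import Data.Integer.Properties as ℤ
open import Data.Rational as ℚ using (ℚ; mkℚ; 0ℚ; ½)
import Data.Rational.Properties as ℚ
open import Data.Fin using (Fin; zero; suc; toℕ)
open import Data.Product using (Σ; ∃; ∃₂; _×_; _,_; proj₁; proj₂)
open import Data.Vec as Vec using (Vec; []; _∷_; lookup)
import Data.Vec.Properties as Vec
open import Data.List as List using (List; []; _∷_)
open import Data.List.Relation.Unary.All as All using (All; []; _∷_)
import Data.List.Relation.Unary.All.Properties as All
open import Data.List.Relation.Unary.Any using (here; there)
open import Data.List.Membership.Propositional using (_∈_)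
open import Data.Unit.Polymorphic using (⊤; tt)
open import Algebra.Structures using (IsMonoid)
open import Relation.Unary using (Pred; _⊆_)
open import Relation.Binary using (Setoid; IsEquivalence; Rel)
open import Relation.Binary.PropositionalEquality as ≡ using (_≡_; refl; cong; cong₂; subst; subst₂)
open import Function using (_∘_; id; _⇔_; mk⇔; Equivalence)
open import Data.Product.Relation.Binary.Pointwise.NonDependent using (×-setoid)

infixl 6 _+_
infix 4 _≤_ _<_

record ℚ≥0 : Set where
  constructor _,_
  field
    value : ℚ
    0≤value : 0ℚ ℚ.≤ value
open ℚ≥0

record _≤_ (p q : ℚ≥0) : Set where
  constructor mk≤
  field get≤ : value p ℚ.≤ value q
open _≤_

record _<_ (p q : ℚ≥0) : Set where
  constructor mk<
  field get< : value p ℚ.< value q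
open _<_

opaque
  _+_ : ℚ≥0 → ℚ≥0 → ℚ≥0
  (p , 0≤p) + (q , 0≤q) = p ℚ.+ q , ℚ.+-mono-≤ 0≤p 0≤q

  value-+ : ∀ p q → value (p + q) ≡ value p ℚ.+ value q
  value-+ _ _ = refl

0# : ℚ≥0
0# = 0ℚ , ℚ.≤-refl

Positive : Pred ℚ≥0 0ℓ
Positive ε = 0# < ε

ext : ∀ {p q} → value p ≡ value q → p ≡ q
ext {p , h} {.p , k} refl = cong (p ,_) (ℚ.≤-irrelevant h k)

≤-refl : ∀ {p} → p ≤ p
≤-refl = mk≤ ℚ.≤-refl

≤-reflexive : ∀ {p q} → p ≡ q → p ≤ q
≤-reflexive {p} refl = ≤-refl {p}

≤-trans : ∀ {p q r} → p ≤ q → q ≤ r → p ≤ r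
≤-trans (mk≤ h) (mk≤ k) = mk≤ (ℚ.≤-trans h k)

<⇒≤ : ∀ {p q} → p < q → p ≤ q
<⇒≤ (mk< h) = mk≤ (ℚ.<⇒≤ h)

≤-<-trans : ∀ {p q r} → p ≤ q → q < r → p < r
≤-<-trans (mk≤ h) (mk< k) = mk< (ℚ.≤-<-trans h k)

<-dense : ∀ {p q} → p < q → ∃ λ m → p < m × m < q
<-dense {p , 0≤p} (mk< p<q) =
  let m , p<m , m<q = ℚ.<-dense p<q
  in (m , ℚ.≤-trans 0≤p (ℚ.<⇒≤ p<m)) , mk< p<m , mk< m<q

≤-closed : ∀ {p q} → (∀ q′ → q < q′ → p ≤ q′) → p ≤ q
≤-closed {p} {q} h = mk≤ (ℚ.≮⇒≥ λ q<p →
  let m , q<m , mk< m<p = <-dense {q} {p} (mk< q<p)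
  in ℚ.<-irrefl refl (ℚ.<-≤-trans m<p (get≤ (h m q<m))))

0≤ : ∀ {p} → 0# ≤ p
0≤ {p} = mk≤ (0≤value p)

opaque
  unfolding _+_

  +-comm : ∀ p q → p + q ≡ q + p
  +-comm p q = ext (ℚ.+-comm (value p) (value q))

  +-assoc : ∀ p q r → p + q + r ≡ p + (q + r)
  +-assoc p q r = ext (ℚ.+-assoc (value p) (value q) (value r))

  +-identityʳ : ∀ p → p + 0# ≡ p
  +-identityʳ p = ext (ℚ.+-identityʳ (value p))

  +-identityˡ : ∀ p → 0# + p ≡ p
  +-identityˡ p = ext (ℚ.+-identityˡ (value p))

  +-mono-≤ : ∀ {p q r s} → p ≤ q → r ≤ s → p + r ≤ q + s
  +-mono-≤ (mk≤ h) (mk≤ k) = mk≤ (ℚ.+-mono-≤ h k)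

  p<p+ε : ∀ {p ε} → Positive ε → p < p + ε
  p<p+ε {p} {ε} (mk< 0<ε) = subst (_< p + ε) (+-identityʳ p)
    (mk< (ℚ.+-monoʳ-< (value p) 0<ε))

  ∃-difference : ∀ {p q} → p < q → ∃ λ ε → Positive ε × p + ε ≡ q
  ∃-difference {p , _} {q , _} (mk< p<q) = (ε , ℚ.<⇒≤ 0<ε) , mk< 0<ε , ext eq
    where
    ε : ℚ
    ε = ℚ.- p ℚ.+ q
    0<ε : 0ℚ ℚ.< ε
    0<ε = subst (ℚ._< ε) (ℚ.+-inverseˡ p) (ℚ.+-monoʳ-< (ℚ.- p) p<q)
    eq : p ℚ.+ ε ≡ q
    eq = ≡.trans (≡.sym (ℚ.+-assoc p (ℚ.- p) q))
      (≡.trans (cong (ℚ._+ q) (ℚ.+-inverseʳ p)) (ℚ.+-identityˡ q))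

  halve : ∀ {ε} → Positive ε → ∃ λ δ → Positive δ × δ + δ ≡ ε
  halve {ε , _} (mk< 0<ε) = (δ , ℚ.<⇒≤ 0<δ) , mk< 0<δ , ext eq
    where
    δ : ℚ
    δ = ½ ℚ.* ε
    0<δ : 0ℚ ℚ.< δ
    0<δ = subst (ℚ._< δ) (ℚ.*-zeroʳ ½) (ℚ.*-monoʳ-<-pos ½ 0<ε)
    eq : δ ℚ.+ δ ≡ ε
    eq = ≡.trans (≡.sym (ℚ.*-distribʳ-+ ε ½ ½)) (ℚ.*-identityˡ ε)

+-interchange : ∀ p q r s → (p + q) + (r + s) ≡ (p + r) + (q + s)
+-interchange p q r s = begin
  (p + q) + (r + s) ≡⟨ +-assoc p q (r + s) ⟩
  p + (q + (r + s)) ≡⟨ cong (p +_) (+-assoc q r s) ⟨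
  p + (q + r + s)   ≡⟨ cong (λ z → p + (z + s)) (+-comm q r) ⟩
  p + (r + q + s)   ≡⟨ cong (p +_) (+-assoc r q s) ⟩
  p + (r + (q + s)) ≡⟨ +-assoc p r (q + s) ⟨
  (p + r) + (q + s) ∎
  where open ≡.≡-Reasoning

p≤p+q : ∀ {p q} → p ≤ p + q
p≤p+q {p} {q} = subst (_≤ p + q) (+-identityʳ p) (+-mono-≤ ≤-refl 0≤)

q≤p+q : ∀ {p q} → q ≤ p + q
q≤p+q {p} {q} = subst (_≤ p + q) (+-identityˡ q) (+-mono-≤ 0≤ ≤-refl)

opaque
  nullSequence : ∃ λ (a : ℕ → ℚ≥0) → (∀ k → Positive (a k)) ×
    (∀ {ε} → Positive ε → ∃ λ K → ∀ k → K ℕ.≤ k → a k ≤ ε)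
  nullSequence = a , (λ k → mk< (0<1/suc k)) , null
    where
    1/suc : ℕ → ℚ
    1/suc k = mkℚ (ℤ.+ 1) k (Coprime.1-coprimeTo (ℕ.suc k))
    0<1/suc : ∀ k → 0ℚ ℚ.< 1/suc k
    0<1/suc k = ℚ.*<* (ℤ.+<+ (ℕ.s≤s ℕ.z≤n))
    a : ℕ → ℚ≥0
    a k = 1/suc k , ℚ.<⇒≤ (0<1/suc k)
    null : ∀ {ε} → Positive ε → ∃ λ K → ∀ k → K ℕ.≤ k → a k ≤ ε
    null {mkℚ (ℤ.+ 0) d c , _} (mk< (ℚ.*<* (ℤ.+<+ ())))
    null {mkℚ (ℤ.+ (ℕ.suc n)) d c , _} _ = d , λ k d≤k → mk≤ (ℚ.*≤* (subst₂ ℤ._≤_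
      (≡.sym (ℤ.*-identityˡ (ℤ.+ ℕ.suc d))) (ℤ.pos-* (ℕ.suc n) (ℕ.suc k))
      (ℤ.+≤+ (ℕ.≤-trans (ℕ.s≤s d≤k) (ℕ.m≤m+n (ℕ.suc k) (n ℕ.* ℕ.suc k))))))
    null {mkℚ ℤ.-[1+ n ] d c , _} (mk< (ℚ.*<* ()))

-- A point r of [0,∞] is given by the closed upper cut of those q ∈ ℚ≥0 with
-- r ≤ q, written r ≼ q.  The empty cut is ∞.
record [0,∞] ℓ : Set (Level.suc ℓ) where
  no-eta-equality
  infix 4 _≼_
  field
    _≼_    : Pred ℚ≥0 ℓ
    upper  : ∀ {p q} → p ≤ q → _≼_ p → _≼_ q
    closed : ∀ {q} → (∀ q′ → q < q′ → _≼_ q′) → _≼_ q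
open [0,∞]

module _ {ℓ : Level} where

  infix 4 _≤∞_ _≃∞_
  infixl 6 _+∞_

  _≤∞_ _≃∞_ : Rel ([0,∞] ℓ) ℓ
  r ≤∞ s = ∀ q → s ≼ q → r ≼ q
  r ≃∞ s = r ≤∞ s × s ≤∞ r

  0∞ : [0,∞] ℓ
  0∞ ._≼_ _ = ⊤
  0∞ .upper _ _ = tt
  0∞ .closed _ = tt

  ⌈_⌉ : ℚ≥0 → [0,∞] ℓ
  ⌈ p ⌉ ._≼_ q = Lift ℓ (p ≤ q)
  ⌈ p ⌉ .upper q≤q′ (lift p≤q) = lift (≤-trans p≤q q≤q′)
  ⌈ p ⌉ .closed h = lift (≤-closed λ q′ q<q′ → lower (h q′ q<q′))

  closed⁺ : (r : [0,∞] ℓ) → ∀ {q} → (∀ {ε} → Positive ε → r ≼ q + ε) → r ≼ q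
  closed⁺ r h = closed r λ q′ q<q′ →
    let ε , 0<ε , eq = ∃-difference q<q′ in subst (r ≼_) eq (h 0<ε)

  -- The rationals a + b with r ≤ a and s ≤ b need not attain r + s.
  _+∞_ : [0,∞] ℓ → [0,∞] ℓ → [0,∞] ℓ
  (r +∞ s) ._≼_ q = ∀ q′ → q < q′ → ∃₂ λ a b → r ≼ a × s ≼ b × a + b ≤ q′
  (r +∞ s) .upper p≤q h q′ q<q′ = h q′ (≤-<-trans p≤q q<q′)
  (r +∞ s) .closed h q′ q<q′ = let m , q<m , m<q′ = <-dense q<q′ in h m q<m q′ m<q′

  sup : ∀ {n} → (Fin n → [0,∞] ℓ) → [0,∞] ℓ
  sup r ._≼_ q = ∀ i → r i ≼ q
  sup r .upper p≤q h i = upper (r i) p≤q (h i)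
  sup r .closed h i = closed (r i) λ q′ q<q′ → h q′ q<q′ i

  ≼0⇒≃0 : ∀ r → r ≼ 0# → r ≃∞ 0∞
  ≼0⇒≃0 r r≼0 = (λ q _ → upper r 0≤ r≼0) , λ _ _ → tt

  +∞-intro : ∀ (r s : [0,∞] ℓ) {a b} → r ≼ a → s ≼ b → r +∞ s ≼ a + b
  +∞-intro r s {a} {b} r≼a s≼b q′ a+b<q′ = a , b , r≼a , s≼b , <⇒≤ a+b<q′

  +∞-elimˡ : ∀ (r s : [0,∞] ℓ) {q} → r +∞ s ≼ q → r ≼ q
  +∞-elimˡ r s h = closed r λ q′ q<q′ →
    let a , b , r≼a , s≼b , a+b≤q′ = h q′ q<q′ in upper r (≤-trans p≤p+q a+b≤q′) r≼a

  +∞-elimʳ : ∀ (r s : [0,∞] ℓ) {q} → r +∞ s ≼ q → s ≼ q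
  +∞-elimʳ r s h = closed s λ q′ q<q′ →
    let a , b , r≼a , s≼b , a+b≤q′ = h q′ q<q′ in upper s (≤-trans q≤p+q a+b≤q′) s≼b

  ≤∞-+∞ : ∀ (t r s : [0,∞] ℓ) →
    (∀ {a b} → r ≼ a → s ≼ b → t ≼ a + b) → t ≤∞ r +∞ s
  ≤∞-+∞ t r s h q r+s≼q = closed t λ q′ q<q′ →
    let a , b , r≼a , s≼b , a+b≤q′ = r+s≼q q′ q<q′ in upper t a+b≤q′ (h r≼a s≼b)

-- Extended metric spaces are setoid-based: _≈_ plays the role of equality of points.
record ExtMet ℓ : Set (Level.suc ℓ) where
  no-eta-equality
  field
    setoid : Setoid ℓ ℓ
  open Setoid setoid public using (Carrier; _≈_; isEquivalence)
    renaming (refl to ≈-refl; reflexive to ≈-reflexive; sym to ≈-sym; trans to ≈-trans)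
  field
    d        : Carrier → Carrier → [0,∞] ℓ
    d≃0⇔≈    : ∀ x y → d x y ≃∞ 0∞ ⇔ x ≈ y
    d-sym    : ∀ x y → d x y ≃∞ d y x
    triangle : ∀ x y z → d x z ≤∞ d x y +∞ d y z

  ≈⇒≼ : ∀ {x y q} → x ≈ y → d x y ≼ q
  ≈⇒≼ {x} {y} x≈y = proj₁ (Equivalence.from (d≃0⇔≈ x y) x≈y) _ tt

  ≼0⇒≈ : ∀ {x y} → d x y ≼ 0# → x ≈ y
  ≼0⇒≈ {x} {y} h = Equivalence.to (d≃0⇔≈ x y) (≼0⇒≃0 (d x y) h)

  ≼-refl : ∀ {x q} → d x x ≼ q
  ≼-refl = ≈⇒≼ ≈-refl

  ≼-sym : ∀ {x y q} → d x y ≼ q → d y x ≼ q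
  ≼-sym {x} {y} = proj₂ (d-sym x y) _

  ≼-trans : ∀ {x y z p q} → d x y ≼ p → d y z ≼ q → d x z ≼ p + q
  ≼-trans {x} {y} {z} h k = triangle x y z _ (+∞-intro (d x y) (d y z) h k)

  ≼-upper : ∀ {x y p q} → p ≤ q → d x y ≼ p → d x y ≼ q
  ≼-upper {x} {y} = upper (d x y)

  ≼-respˡ : ∀ {x y z q} → x ≈ y → d x z ≼ q → d y z ≼ q
  ≼-respˡ {y = y} {z} {q} x≈y h =
    subst (d y z ≼_) (+-identityˡ q) (≼-trans (≈⇒≼ (≈-sym x≈y)) h)

  ≼-respʳ : ∀ {x y z q} → x ≈ y → d z x ≼ q → d z y ≼ q
  ≼-respʳ x≈y h = ≼-sym (≼-respˡ x≈y (≼-sym h))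

∣_∣ : ∀ {ℓ} → ExtMet ℓ → Set ℓ
∣_∣ = ExtMet.Carrier

-- Metric quotient of a pseudometric: points at distance 0 are identified.
fromPseudometric : ∀ {ℓ} (A : Set ℓ) (d : A → A → [0,∞] ℓ) →
  (∀ x → d x x ≼ 0#) → (∀ x y q → d x y ≼ q → d y x ≼ q) →
  (∀ x y z p q → d x y ≼ p → d y z ≼ q → d x z ≼ p + q) → ExtMet ℓ
fromPseudometric A d d-refl d-sym d-trans .ExtMet.setoid = record
  { Carrier = A
  ; _≈_ = λ x y → d x y ≼ 0#
  ; isEquivalence = record
      { refl  = λ {x} → d-refl x
      ; sym   = λ {x} {y} → d-sym x y 0#
      ; trans = λ {x} {y} {z} h k →
          subst (d x z ≼_) (+-identityˡ 0#) (d-trans x y z 0# 0# h k)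
      }
  }
fromPseudometric A d d-refl d-sym d-trans .ExtMet.d = d
fromPseudometric A d d-refl d-sym d-trans .ExtMet.d≃0⇔≈ x y =
  mk⇔ (λ h → proj₁ h 0# tt) (≼0⇒≃0 (d x y))
fromPseudometric A d d-refl d-sym d-trans .ExtMet.d-sym x y = d-sym y x , d-sym x y
fromPseudometric A d d-refl d-sym d-trans .ExtMet.triangle x y z =
  ≤∞-+∞ (d x z) (d x y) (d y z) (d-trans x y z _ _)

module □ {ℓ : Level} (X Y : ExtMet ℓ) where
  private module X = ExtMet X
  private module Y = ExtMet Y

  d : ∣ X ∣ × ∣ Y ∣ → ∣ X ∣ × ∣ Y ∣ → [0,∞] ℓ
  d (x , y) (x′ , y′) = X.d x x′ +∞ Y.d y y′

  d-zero : ∀ u v → d u v ≃∞ 0∞ ⇔ (proj₁ u X.≈ proj₁ v × proj₂ u Y.≈ proj₂ v)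
  d-zero (x , y) (x′ , y′) = mk⇔
    (λ h → X.≼0⇒≈ (+∞-elimˡ (X.d x x′) (Y.d y y′) (proj₁ h 0# tt)) ,
           Y.≼0⇒≈ (+∞-elimʳ (X.d x x′) (Y.d y y′) (proj₁ h 0# tt)))
    (λ (x≈x′ , y≈y′) → ≼0⇒≃0 (d (x , y) (x′ , y′))
      (subst (d (x , y) (x′ , y′) ≼_) (+-identityˡ 0#)
        (+∞-intro (X.d x x′) (Y.d y y′) (X.≈⇒≼ x≈x′) (Y.≈⇒≼ y≈y′))))

  d-sym : ∀ u v q → d u v ≼ q → d v u ≼ q
  d-sym _ _ _ h q′ q<q′ =
    let a , b , h₁ , h₂ , le = h q′ q<q′ in a , b , X.≼-sym h₁ , Y.≼-sym h₂ , le

  d-trans : ∀ u v w {p q} → d u v ≼ p → d v w ≼ q → d u w ≼ p + q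
  d-trans u v w {p} {q} h k = closed⁺ (d u w) λ {ε} 0<ε →
    let δ , 0<δ , δ+δ≡ε = halve 0<ε
        a , b , h₁ , h₂ , le  = h (p + δ) (p<p+ε 0<δ)
        a′ , b′ , k₁ , k₂ , le′ = k (q + δ) (p<p+ε 0<δ)
    in upper (d u w)
         (subst₂ _≤_ (+-interchange a b a′ b′)
           (≡.trans (+-interchange p δ q δ) (cong (p + q +_) δ+δ≡ε)) (+-mono-≤ le le′))
         (+∞-intro (X.d _ _) (Y.d _ _) (X.≼-trans h₁ k₁) (Y.≼-trans h₂ k₂))

infixr 7 _□_

_□_ : ∀ {ℓ} → ExtMet ℓ → ExtMet ℓ → ExtMet ℓ
(X □ Y) .ExtMet.setoid = ×-setoid (ExtMet.setoid X) (ExtMet.setoid Y)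
(X □ Y) .ExtMet.d = □.d X Y
(X □ Y) .ExtMet.d≃0⇔≈ = □.d-zero X Y
(X □ Y) .ExtMet.d-sym u v = □.d-sym X Y v u , □.d-sym X Y u v
(X □ Y) .ExtMet.triangle u v w =
  ≤∞-+∞ (□.d X Y u w) (□.d X Y u v) (□.d X Y v w) (□.d-trans X Y u v w)

-- Preservation of _≈_ follows, as _≈_ is distance 0.
record NonExpansive {ℓ} (X Y : ExtMet ℓ) : Set ℓ where
  no-eta-equality
  private module X = ExtMet X
  private module Y = ExtMet Y
  infixl 20 _$_
  field
    _$_          : ∣ X ∣ → ∣ Y ∣
    nonExpansive : ∀ x x′ → Y.d (_$_ x) (_$_ x′) ≤∞ X.d x x′

  resp-≈ : ∀ {x x′} → x X.≈ x′ → _$_ x Y.≈ _$_ x′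
  resp-≈ x≈x′ = Y.≼0⇒≈ (nonExpansive _ _ 0# (X.≈⇒≼ x≈x′))
open NonExpansive

Eventually : ∀ {ℓ} → (ℕ → Set ℓ) → Set ℓ
Eventually P = ∃ λ N → ∀ n → N ℕ.≤ n → P n

always : ∀ {ℓ} {P : ℕ → Set ℓ} → (∀ n → P n) → Eventually P
always h = 0 , λ n _ → h n

eventually-map : ∀ {a b} {P : ℕ → Set a} {Q : ℕ → Set b} →
  (∀ n → P n → Q n) → Eventually P → Eventually Q
eventually-map f (N , h) = N , λ n N≤n → f n (h n N≤n)

eventually-zip : ∀ {a b c} {P : ℕ → Set a} {Q : ℕ → Set b} {R : ℕ → Set c} →
  (∀ n → P n → Q n → R n) → Eventually P → Eventually Q → Eventually R
eventually-zip f (N , h) (M , k) = N ℕ.⊔ M , λ n le →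
  f n (h n (ℕ.≤-trans (ℕ.m≤m⊔n N M) le)) (k n (ℕ.≤-trans (ℕ.m≤n⊔m N M) le))

eventually-× : ∀ {a b} {P : ℕ → Set a} {Q : ℕ → Set b} →
  Eventually P → Eventually Q → Eventually (λ n → P n × Q n)
eventually-× = eventually-zip (λ _ → _,_)

eventually-elim : ∀ {a} {A : Set a} → Eventually (λ _ → A) → A
eventually-elim (N , h) = h N ℕ.≤-refl

fin-bounded : ∀ n (N : Fin n → ℕ) → ∃ λ M → ∀ i → N i ℕ.≤ M
fin-bounded ℕ.zero N = 0 , λ ()
fin-bounded (ℕ.suc n) N = let M , h = fin-bounded n (N ∘ suc) in
  N zero ℕ.⊔ M , λ { zero → ℕ.m≤m⊔n (N zero) M
                   ; (suc i) → ℕ.≤-trans (h i) (ℕ.m≤n⊔m (N zero) M) }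

eventually-all : ∀ {ℓ} n {P : Fin n → ℕ → Set ℓ} →
  (∀ i → Eventually (P i)) → Eventually (λ k → ∀ i → P i k)
eventually-all n h = let M , N≤M = fin-bounded n (proj₁ ∘ h) in
  M , λ k M≤k i → proj₂ (h i) k (ℕ.≤-trans (N≤M i) M≤k)

module _ {ℓ : Level} (X : ExtMet ℓ) where
  open ExtMet X

  Cauchy : (ℕ → Carrier) → Set ℓ
  Cauchy x = ∀ {ε} → Positive ε →
    ∃ λ N → ∀ m n → N ℕ.≤ m → N ℕ.≤ n → d (x m) (x n) ≼ ε

  infix 4 _⟶_
  _⟶_ : (ℕ → Carrier) → Carrier → Set ℓ
  x ⟶ l = ∀ {ε} → Positive ε → Eventually λ n → d (x n) l ≼ ε

  Complete : Set ℓ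
  Complete = ∀ x → Cauchy x → ∃ λ l → x ⟶ l

  lim-≼ : ∀ {x y l m q} → x ⟶ l → y ⟶ m →
    (∀ q′ → q < q′ → Eventually λ n → d (x n) (y n) ≼ q′) → d l m ≼ q
  lim-≼ {x} {y} {l} {m} {q} x⟶l y⟶m h = closed⁺ (d l m) λ {ε} 0<ε →
    let δ , 0<δ , δ+δ≡ε = halve 0<ε
        η , 0<η , η+η≡δ = halve 0<δ
        eq : η + (q + δ) + η ≡ q + ε
        eq = begin
          η + (q + δ) + η ≡⟨ cong (_+ η) (+-comm η (q + δ)) ⟩
          q + δ + η + η   ≡⟨ +-assoc (q + δ) η η ⟩
          q + δ + (η + η) ≡⟨ cong (q + δ +_) η+η≡δ ⟩
          q + δ + δ       ≡⟨ +-assoc q δ δ ⟩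
          q + (δ + δ)     ≡⟨ cong (q +_) δ+δ≡ε ⟩
          q + ε           ∎
    in eventually-elim (eventually-zip {R = λ _ → d l m ≼ q + ε}
         (λ n k (k₁ , k₂) → subst (d l m ≼_) eq (≼-trans (≼-trans (≼-sym k₁) k) k₂))
         (h (q + δ) (p<p+ε 0<δ)) (eventually-× (x⟶l 0<η) (y⟶m 0<η)))
    where open ≡.≡-Reasoning

  lim-≈ : ∀ {x y l m} → x ⟶ l → y ⟶ m → (∀ n → x n ≈ y n) → l ≈ m
  lim-≈ x⟶l y⟶m h = ≼0⇒≈ (lim-≼ x⟶l y⟶m λ _ _ → always λ n → ≈⇒≼ (h n))

module _ {ℓ : Level} {X Y : ExtMet ℓ} (f : NonExpansive X Y) where

  cauchy-map : ∀ {x} → Cauchy X x → Cauchy Y (λ n → f $ x n)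
  cauchy-map c 0<ε = let N , h = c 0<ε in
    N , λ m n N≤m N≤n → nonExpansive f _ _ _ (h m n N≤m N≤n)

  lim-map : ∀ {x l} → _⟶_ X x l → _⟶_ Y (λ n → f $ x n) (f $ l)
  lim-map x⟶l 0<ε = eventually-map (λ n → nonExpansive f _ _ _) (x⟶l 0<ε)

opaque
  □-complete : ∀ {ℓ} {X Y : ExtMet ℓ} → Complete X → Complete Y → Complete (X □ Y)
  □-complete {X = X} {Y} cX cY u c =
    let l , p⟶l = cX (proj₁ ∘ u) λ 0<ε → let N , h = c 0<ε in
                    N , λ m n N≤m N≤n → +∞-elimˡ (X.d _ _) (Y.d _ _) (h m n N≤m N≤n)
        m , q⟶m = cY (proj₂ ∘ u) λ 0<ε → let N , h = c 0<ε in
                    N , λ m n N≤m N≤n → +∞-elimʳ (X.d _ _) (Y.d _ _) (h m n N≤m N≤n)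
    in (l , m) , λ 0<ε →
         let δ , 0<δ , δ+δ≡ε = halve 0<ε in
         eventually-zip
           (λ n h₁ h₂ → subst (ExtMet.d (X □ Y) (u n) (l , m) ≼_) δ+δ≡ε
             (+∞-intro (X.d _ _) (Y.d _ _) h₁ h₂))
           (p⟶l 0<δ) (q⟶m 0<δ)
    where
    module X = ExtMet X
    module Y = ExtMet Y

record CauchySequence {ℓ} (X : ExtMet ℓ) : Set ℓ where
  no-eta-equality
  field
    seq    : ℕ → ∣ X ∣
    cauchy : Cauchy X seq
open CauchySequence

module _ {ℓ : Level} (X : ExtMet ℓ) where
  open ExtMet X

  limDist : (x y : ℕ → Carrier) → [0,∞] ℓ
  limDist x y ._≼_ q = ∀ q′ → q < q′ → Eventually λ n → d (x n) (y n) ≼ q′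
  limDist x y .upper p≤q h q′ q<q′ = h q′ (≤-<-trans p≤q q<q′)
  limDist x y .closed h q′ q<q′ = let m , q<m , m<q′ = <-dense q<q′ in h m q<m q′ m<q′

  limDist-refl : ∀ (x : CauchySequence X) → limDist (seq x) (seq x) ≼ 0#
  limDist-refl x q′ _ = always λ n → ≼-refl

  limDist-sym : ∀ (x y : CauchySequence X) q →
    limDist (seq x) (seq y) ≼ q → limDist (seq y) (seq x) ≼ q
  limDist-sym x y q h q′ q<q′ = eventually-map (λ n → ≼-sym) (h q′ q<q′)

  limDist-trans : ∀ (x y z : CauchySequence X) p q → limDist (seq x) (seq y) ≼ p →
    limDist (seq y) (seq z) ≼ q → limDist (seq x) (seq z) ≼ p + q
  limDist-trans x y z p q h k q′ p+q<q′ =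
    let ε , 0<ε , eq = ∃-difference p+q<q′
        δ , 0<δ , δ+δ≡ε = halve 0<ε
    in eventually-zip
         (λ n h₁ h₂ → subst (d (seq x n) (seq z n) ≼_)
           (≡.trans (+-interchange p δ q δ) (≡.trans (cong (p + q +_) δ+δ≡ε) eq))
           (≼-trans h₁ h₂))
         (h (p + δ) (p<p+ε 0<δ)) (k (q + δ) (p<p+ε 0<δ))

  private
    pseudo : ExtMet ℓ
    pseudo = fromPseudometric (CauchySequence X) (λ x y → limDist (seq x) (seq y))
      limDist-refl limDist-sym limDist-trans

  Completion : ExtMet ℓ
  Completion .ExtMet.setoid   = ExtMet.setoid pseudo
  Completion .ExtMet.d        = ExtMet.d pseudo
  Completion .ExtMet.d≃0⇔≈    = ExtMet.d≃0⇔≈ pseudo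
  Completion .ExtMet.d-sym    = ExtMet.d-sym pseudo
  Completion .ExtMet.triangle = ExtMet.triangle pseudo

  const : Carrier → CauchySequence X
  const x .seq _ = x
  const x .cauchy _ = 0 , λ _ _ _ _ → ≼-refl

  embed : NonExpansive X Completion
  embed ._$_ = const
  embed .nonExpansive x y q h q′ q<q′ = always λ _ → ≼-upper (<⇒≤ q<q′) h

  embed-reflects : ∀ {x y q} → ExtMet.d Completion (const x) (const y) ≼ q → d x y ≼ q
  embed-reflects {x} {y} h = closed (d x y) λ q′ q<q′ →
    eventually-elim (h q′ q<q′)

  embed-tail : ∀ x {ε} (0<ε : Positive ε) n → proj₁ (cauchy x 0<ε) ℕ.≤ n →
    ExtMet.d Completion x (const (seq x n)) ≼ ε
  embed-tail x 0<ε n N≤n q′ ε<q′ = proj₁ (cauchy x 0<ε) , λ m N≤m →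
    ≼-upper (<⇒≤ ε<q′) (proj₂ (cauchy x 0<ε) m n N≤m N≤n)

  embed-⟶ : ∀ x → _⟶_ Completion (λ n → const (seq x n)) x
  embed-⟶ x 0<ε = proj₁ (cauchy x 0<ε) , λ n N≤n →
    ExtMet.≼-sym Completion {x} {const (seq x n)} (embed-tail x 0<ε n N≤n)

  opaque
    completion-complete : Complete Completion
    completion-complete x c = ŷ , x⟶y
      where
      module C = ExtMet Completion
      a : ℕ → ℚ≥0
      a = proj₁ nullSequence
      0<a : ∀ k → Positive (a k)
      0<a = proj₁ (proj₂ nullSequence)
      a⟶0 : ∀ {ε} → Positive ε → Eventually λ k → a k ≤ ε
      a⟶0 = proj₂ (proj₂ nullSequence)
      N : ℕ → ℕ
      N k = proj₁ (cauchy (x k) (0<a k))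
      y : ℕ → Carrier
      y k = seq (x k) (N k)
      near : ∀ k → C.d (x k) (const (y k)) ≼ a k
      near k = embed-tail (x k) (0<a k) (N k) ℕ.≤-refl
      y-cauchy : Cauchy X y
      y-cauchy {ε} 0<ε =
        let δ , 0<δ , δ+δ≡ε = halve 0<ε
            η , 0<η , η+η≡δ = halve 0<δ
            K , h = a⟶0 0<η
            M , k = c 0<δ
        in K ℕ.⊔ M , λ m n le le′ →
           let near-m = C.≼-upper {x m} {const (y m)}
                 (h m (ℕ.≤-trans (ℕ.m≤m⊔n K M) le)) (near m)
               near-n = C.≼-upper {x n} {const (y n)}
                 (h n (ℕ.≤-trans (ℕ.m≤m⊔n K M) le′)) (near n)
               x-m-n = k m n (ℕ.≤-trans (ℕ.m≤n⊔m K M) le) (ℕ.≤-trans (ℕ.m≤n⊔m K M) le′)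
               eq : η + δ + η ≡ ε
               eq = ≡.trans (cong (_+ η) (+-comm η δ)) (≡.trans (+-assoc δ η η)
                 (≡.trans (cong (δ +_) η+η≡δ) δ+δ≡ε))
           in embed-reflects (subst (C.d (const (y m)) (const (y n)) ≼_) eq
                (C.≼-trans {const (y m)} {x n} {const (y n)}
                  (C.≼-trans {const (y m)} {x m} {x n}
                    (C.≼-sym {x m} {const (y m)} near-m) x-m-n) near-n))
      ŷ : CauchySequence X
      ŷ .seq = y
      ŷ .cauchy = y-cauchy
      x⟶y : _⟶_ Completion x ŷ
      x⟶y {ε} 0<ε =
        let δ , 0<δ , δ+δ≡ε = halve 0<ε in
        eventually-zip
          (λ n h₁ h₂ → subst (C.d (x n) ŷ ≼_) δ+δ≡ε (C.≼-trans {x n} {const (y n)} {ŷ}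
            (C.≼-upper {x n} {const (y n)} h₁ (near n)) h₂))
          (a⟶0 0<δ) (embed-⟶ ŷ 0<δ)

record Signature ℓ : Set (Level.suc ℓ) where
  field
    Op    : Set ℓ
    arity : Op → ℕ
open Signature

data Term {ℓ x} (S : Signature ℓ) (X : Set x) : Set (ℓ ⊔ x) where
  var : X → Term S X
  op  : (f : Op S) → Vec (Term S X) (arity S f) → Term S X

infix 15 _[_] _[_]*

mutual
  _[_] : ∀ {ℓ x y} {S : Signature ℓ} {X : Set x} {Y : Set y} →
    Term S X → (X → Term S Y) → Term S Y
  var x   [ σ ] = σ x
  op f ts [ σ ] = op f (ts [ σ ]*)

  _[_]* : ∀ {ℓ x y n} {S : Signature ℓ} {X : Set x} {Y : Set y} →
    Vec (Term S X) n → (X → Term S Y) → Vec (Term S Y) n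
  [] [ σ ]*       = []
  (t ∷ ts) [ σ ]* = t [ σ ] ∷ ts [ σ ]*

V : Set
V = ℕ

infix 6 _=[_]_
infix 4 _⊢_

record QuantEq {ℓ} (S : Signature ℓ) : Set ℓ where
  constructor _=[_]_
  field
    lhs   : Term S V
    bound : ℚ≥0
    rhs   : Term S V
open QuantEq

-- A finite set of hypotheses is listed, with order and repetitions immaterial.
record CondQuantEq {ℓ} (S : Signature ℓ) : Set ℓ where
  constructor _⊢_
  field
    hypotheses : List (QuantEq S)
    conclusion : QuantEq S

_[_]ᵉ : ∀ {ℓ} {S : Signature ℓ} → QuantEq S → (V → Term S V) → QuantEq S
(t =[ ε ] s) [ σ ]ᵉ = t [ σ ] =[ ε ] s [ σ ]

module _ {ℓ : Level} {S : Signature ℓ} where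

  varsEq : ∀ {n} → Vec V n → ℚ≥0 → Vec V n → List (QuantEq S)
  varsEq xs ε ys = List.tabulate λ i → var (lookup xs i) =[ ε ] var (lookup ys i)

  record IsTheory (U : Pred (CondQuantEq S) ℓ) : Set ℓ where
    no-eta-equality
    field
      reflexivity  : ∀ x → U ([] ⊢ var x =[ 0# ] var x)
      symmetry     : ∀ x y ε → U (var x =[ ε ] var y ∷ [] ⊢ var y =[ ε ] var x)
      triangle     : ∀ x y z ε ε′ →
        U (var x =[ ε ] var z ∷ var z =[ ε′ ] var y ∷ [] ⊢ var x =[ ε + ε′ ] var y)
      weakening    : ∀ x y ε ε′ → Positive ε′ →
        U (var x =[ ε ] var y ∷ [] ⊢ var x =[ ε + ε′ ] var y)
      congruence   : ∀ f xs ys ε →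
        U (varsEq xs ε ys ⊢ op f (Vec.map var xs) =[ ε ] op f (Vec.map var ys))
      continuity   : ∀ {Γ t s ε} → (∀ ε′ → ε < ε′ → U (Γ ⊢ t =[ ε′ ] s)) →
        U (Γ ⊢ t =[ ε ] s)
      substitution : ∀ {Γ φ} σ → U (Γ ⊢ φ) → U (List.map _[ σ ]ᵉ Γ ⊢ φ [ σ ]ᵉ)
      assumption   : ∀ {Γ φ} → φ ∈ Γ → U (Γ ⊢ φ)
      cut          : ∀ {Γ Θ ψ} → (∀ {φ} → φ ∈ Θ → U (Γ ⊢ φ)) → U (Θ ⊢ ψ) → U (Γ ⊢ ψ)

  data Axiomatized (A : Pred (CondQuantEq S) ℓ) : Pred (CondQuantEq S) ℓ where
    axiom        : ∀ {Γ φ} → A (Γ ⊢ φ) → Axiomatized A (Γ ⊢ φ)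
    reflexivity  : ∀ x → Axiomatized A ([] ⊢ var x =[ 0# ] var x)
    symmetry     : ∀ x y ε → Axiomatized A (var x =[ ε ] var y ∷ [] ⊢ var y =[ ε ] var x)
    triangle     : ∀ x y z ε ε′ → Axiomatized A
      (var x =[ ε ] var z ∷ var z =[ ε′ ] var y ∷ [] ⊢ var x =[ ε + ε′ ] var y)
    weakening    : ∀ x y ε ε′ → Positive ε′ →
      Axiomatized A (var x =[ ε ] var y ∷ [] ⊢ var x =[ ε + ε′ ] var y)
    congruence   : ∀ f xs ys ε → Axiomatized A
      (varsEq xs ε ys ⊢ op f (Vec.map var xs) =[ ε ] op f (Vec.map var ys))
    continuity   : ∀ {Γ t s ε} → (∀ ε′ → ε < ε′ → Axiomatized A (Γ ⊢ t =[ ε′ ] s)) →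
      Axiomatized A (Γ ⊢ t =[ ε ] s)
    substitution : ∀ {Γ φ} σ → Axiomatized A (Γ ⊢ φ) →
      Axiomatized A (List.map _[ σ ]ᵉ Γ ⊢ φ [ σ ]ᵉ)
    assumption   : ∀ {Γ φ} → φ ∈ Γ → Axiomatized A (Γ ⊢ φ)
    cut          : ∀ {Γ Θ ψ} → (∀ {φ} → φ ∈ Θ → Axiomatized A (Γ ⊢ φ)) →
      Axiomatized A (Θ ⊢ ψ) → Axiomatized A (Γ ⊢ ψ)

  opaque
    axiomatized-isTheory : ∀ A → IsTheory (Axiomatized A)
    axiomatized-isTheory A = record
      { reflexivity = reflexivity ; symmetry = symmetry ; triangle = triangle
      ; weakening = weakening ; congruence = congruence ; continuity = continuity
      ; substitution = substitution ; assumption = assumption ; cut = cut }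

  opaque
    axiomatized-smallest : ∀ {A U} → IsTheory U → A ⊆ U → Axiomatized A ⊆ U
    axiomatized-smallest {A} {U} T A⊆U = go
      where
      module T = IsTheory T
      go : Axiomatized A ⊆ U
      go (axiom a) = A⊆U a
      go (reflexivity x) = T.reflexivity x
      go (symmetry x y ε) = T.symmetry x y ε
      go (triangle x y z ε ε′) = T.triangle x y z ε ε′
      go (weakening x y ε ε′ h) = T.weakening x y ε ε′ h
      go (congruence f xs ys ε) = T.congruence f xs ys ε
      go (continuity h) = T.continuity λ ε′ ε<ε′ → go (h ε′ ε<ε′)
      go (substitution σ h) = T.substitution σ (go h)
      go (assumption h) = T.assumption h
      go (cut h k) = T.cut (λ φ∈Θ → go (h φ∈Θ)) (go k)

record QuantAlgebra {ℓ} (S : Signature ℓ) : Set (Level.suc ℓ) where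
  no-eta-equality
  field
    space : ExtMet ℓ
  open ExtMet space public
  field
    interp : (f : Op S) → Vec Carrier (arity S f) → Carrier
    interp-nonExpansive : ∀ f xs ys →
      d (interp f xs) (interp f ys) ≤∞ sup λ i → d (lookup xs i) (lookup ys i)

module _ {ℓ : Level} {S : Signature ℓ} (A : QuantAlgebra S) where
  open QuantAlgebra A

  mutual
    eval : ∀ {x} {X : Set x} → (X → Carrier) → Term S X → Carrier
    eval ι (var x)   = ι x
    eval ι (op f ts) = interp f (eval* ι ts)

    eval* : ∀ {x n} {X : Set x} → (X → Carrier) → Vec (Term S X) n → Vec Carrier n
    eval* ι []       = []
    eval* ι (t ∷ ts) = eval ι t ∷ eval* ι ts

  Holds : (V → Carrier) → QuantEq S → Set ℓ
  Holds ι (t =[ ε ] s) = d (eval ι t) (eval ι s) ≼ ε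

  infix 4 _⊨_
  _⊨_ : CondQuantEq S → Set ℓ
  _⊨_ (Γ ⊢ φ) = ∀ ι → All (Holds ι) Γ → Holds ι φ

  mutual
    eval-subst : ∀ {x y} {X : Set x} {Y : Set y} (ι : Y → Carrier) (σ : X → Term S Y) t →
      eval ι (t [ σ ]) ≡ eval (eval ι ∘ σ) t
    eval-subst ι σ (var x)   = refl
    eval-subst ι σ (op f ts) = cong (interp f) (eval*-subst ι σ ts)

    eval*-subst : ∀ {x y n} {X : Set x} {Y : Set y} (ι : Y → Carrier) (σ : X → Term S Y)
      (ts : Vec (Term S X) n) → eval* ι (ts [ σ ]*) ≡ eval* (eval ι ∘ σ) ts
    eval*-subst ι σ []       = refl
    eval*-subst ι σ (t ∷ ts) = cong₂ _∷_ (eval-subst ι σ t) (eval*-subst ι σ ts)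

  lookup-eval* : ∀ {x n} {X : Set x} (ι : X → Carrier) (ts : Vec (Term S X) n) i →
    lookup (eval* ι ts) i ≡ eval ι (lookup ts i)
  lookup-eval* ι (t ∷ ts) zero    = refl
  lookup-eval* ι (t ∷ ts) (suc i) = lookup-eval* ι ts i

  eval*-vars : ∀ {x n} {X : Set x} (ι : X → Carrier) (xs : Vec X n) →
    eval* ι (Vec.map var xs) ≡ Vec.map ι xs
  eval*-vars ι []       = refl
  eval*-vars ι (x ∷ xs) = cong (ι x ∷_) (eval*-vars ι xs)

  interp-cong : ∀ f {xs ys} → (∀ i → lookup xs i ≈ lookup ys i) → interp f xs ≈ interp f ys
  interp-cong f h = ≼0⇒≈ (interp-nonExpansive f _ _ 0# λ i → ≈⇒≼ (h i))

  holds-subst : ∀ ι σ φ → Holds ι (φ [ σ ]ᵉ) ≡ Holds (eval ι ∘ σ) φ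
  holds-subst ι σ (t =[ ε ] s) =
    cong₂ (λ a b → d a b ≼ ε) (eval-subst ι σ t) (eval-subst ι σ s)

  opaque
    models-isTheory : IsTheory _⊨_
    models-isTheory = record
      { reflexivity  = λ _ _ _ → ≼-refl
      ; symmetry     = λ { _ _ _ _ (h ∷ []) → ≼-sym h }
      ; triangle     = λ { _ _ _ _ _ _ (h ∷ k ∷ []) → ≼-trans h k }
      ; weakening    = λ { _ _ _ _ _ _ (h ∷ []) → ≼-upper p≤p+q h }
      ; congruence   = λ f xs ys ε ι hs → interp-nonExpansive f _ _ ε λ i →
          subst₂ (λ a b → d a b ≼ ε) (≡.sym (lookup-eval*-var ι xs i))
            (≡.sym (lookup-eval*-var ι ys i)) (All.tabulate⁻ hs i)
      ; continuity   = λ h ι hs → closed (d _ _) λ ε′ ε<ε′ → h ε′ ε<ε′ ι hs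
      ; substitution = λ {Γ} {φ} σ h ι hs → subst id (≡.sym (holds-subst ι σ φ))
          (h (eval ι ∘ σ) (All.map (λ {ψ} → subst id (holds-subst ι σ ψ)) (All.map⁻ hs)))
      ; assumption   = λ φ∈Γ ι hs → All.lookup hs φ∈Γ
      ; cut          = λ h k ι hs → k ι (All.tabulate λ φ∈Θ → h φ∈Θ ι hs)
      }
      where
      lookup-eval*-var : ∀ {n} ι (xs : Vec V n) i →
        lookup (eval* ι (Vec.map var xs)) i ≡ ι (lookup xs i)
      lookup-eval*-var ι xs i = ≡.trans (cong (λ v → lookup v i) (eval*-vars ι xs))
        (Vec.lookup-map i ι xs)

record Homomorphism {ℓ} {S : Signature ℓ} (A B : QuantAlgebra S) : Set ℓ where
  no-eta-equality
  private module A = QuantAlgebra A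
  private module B = QuantAlgebra B
  field
    map  : NonExpansive A.space B.space
    homo : ∀ f xs → map $ A.interp f xs B.≈ B.interp f (Vec.map (map $_) xs)
open Homomorphism

module _ {ℓ : Level} {S : Signature ℓ} where

  _⊨*_ : QuantAlgebra S → Pred (CondQuantEq S) ℓ → Set ℓ
  A ⊨* U = ∀ {φ} → U φ → A ⊨ φ

  -- The free quantitative algebra on X satisfying U consists of the terms over X at
  -- the smallest distances compatible with those of X and with U.  The metric
  -- conditions and the non-expansiveness of operations are themselves members of U.
  module FreeAlgebra {U : Pred (CondQuantEq S) ℓ} (T : IsTheory U) (X : ExtMet ℓ) where
    private module X = ExtMet X
    private module T = IsTheory T

    infix 4 _∼[_]_
    data _∼[_]_ : Term S ∣ X ∣ → ℚ≥0 → Term S ∣ X ∣ → Set ℓ where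
      generator  : ∀ {x y ε} → X.d x y ≼ ε → var x ∼[ ε ] var y
      instantiate : ∀ {Γ t s ε} → U (Γ ⊢ t =[ ε ] s) → (σ : V → Term S ∣ X ∣) →
        (∀ {φ} → φ ∈ Γ → lhs φ [ σ ] ∼[ bound φ ] rhs φ [ σ ]) →
        t [ σ ] ∼[ ε ] s [ σ ]
      continuity : ∀ {t s ε} → (∀ ε′ → ε < ε′ → t ∼[ ε′ ] s) → t ∼[ ε ] s

    private
      pick₂ : (t s : Term S ∣ X ∣) → V → Term S ∣ X ∣
      pick₂ t s ℕ.zero    = t
      pick₂ t s (ℕ.suc _) = s

      pick₃ : (t s r : Term S ∣ X ∣) → V → Term S ∣ X ∣
      pick₃ t s r ℕ.zero    = t
      pick₃ t s r (ℕ.suc n) = pick₂ s r n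

      pick : ∀ {n} → Term S ∣ X ∣ → Vec (Term S ∣ X ∣) n → V → Term S ∣ X ∣
      pick t []       k         = t
      pick t (s ∷ ss) ℕ.zero    = s
      pick t (s ∷ ss) (ℕ.suc k) = pick t ss k

      pick-++ˡ : ∀ {n m} t (ss : Vec (Term S ∣ X ∣) n) (rs : Vec (Term S ∣ X ∣) m) i →
        pick t (ss Vec.++ rs) (toℕ i) ≡ lookup ss i
      pick-++ˡ t (s ∷ ss) rs zero    = refl
      pick-++ˡ t (s ∷ ss) rs (suc i) = pick-++ˡ t ss rs i

      pick-++ʳ : ∀ {n m} t (ss : Vec (Term S ∣ X ∣) n) (rs : Vec (Term S ∣ X ∣) m) i →
        pick t (ss Vec.++ rs) (n ℕ.+ toℕ i) ≡ lookup rs i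
      pick-++ʳ t [] (r ∷ rs) zero    = refl
      pick-++ʳ t [] (r ∷ rs) (suc i) = pick-++ʳ t [] rs i
      pick-++ʳ t (s ∷ ss) rs i       = pick-++ʳ t ss rs i

      vars-subst : ∀ {n} (g : Fin n → V) (σ : V → Term S ∣ X ∣) (ts : Vec (Term S ∣ X ∣) n) →
        (∀ i → σ (g i) ≡ lookup ts i) → Vec.map var (Vec.tabulate g) [ σ ]* ≡ ts
      vars-subst g σ [] h = refl
      vars-subst g σ (t ∷ ts) h = cong₂ _∷_ (h zero) (vars-subst (g ∘ suc) σ ts (h ∘ suc))

    ∼-refl : ∀ t → t ∼[ 0# ] t
    ∼-refl t = instantiate (T.reflexivity 0) (λ _ → t) λ ()

    ∼-sym : ∀ t s ε → t ∼[ ε ] s → s ∼[ ε ] t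
    ∼-sym t s ε h = instantiate (T.symmetry 0 1 ε) (pick₂ t s) λ { (here refl) → h }

    ∼-trans : ∀ t s r ε ε′ → t ∼[ ε ] s → s ∼[ ε′ ] r → t ∼[ ε + ε′ ] r
    ∼-trans t s r ε ε′ h k = instantiate (T.triangle 0 2 1 ε ε′) (pick₃ t s r)
      λ { (here refl) → h ; (there (here refl)) → k }

    ∼-weaken : ∀ {t s ε ε′} → ε ≤ ε′ → t ∼[ ε ] s → t ∼[ ε′ ] s
    ∼-weaken {t} {s} {ε} {ε′} ε≤ε′ h = continuity λ ε″ ε′<ε″ →
      let δ , 0<δ , ε+δ≡ε″ = ∃-difference (≤-<-trans ε≤ε′ ε′<ε″) in
      subst (t ∼[_] s) ε+δ≡ε″
        (instantiate (T.weakening 0 1 ε δ 0<δ) (pick₂ t s) λ { (here refl) → h })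

    ∼-op : ∀ f ts ss ε → (∀ i → lookup ts i ∼[ ε ] lookup ss i) → op f ts ∼[ ε ] op f ss
    ∼-op f ts ss ε h = subst₂ (λ us vs → op f us ∼[ ε ] op f vs)
      (vars-subst toℕ σ ts σ-ts) (vars-subst (λ i → n ℕ.+ toℕ i) σ ss σ-ss)
      (instantiate (T.congruence f xs ys ε) σ λ φ∈Γ → All.lookup hyps φ∈Γ)
      where
      n : ℕ
      n = arity S f
      σ : V → Term S ∣ X ∣
      σ = pick (op f ts) (ts Vec.++ ss)
      xs ys : Vec V n
      xs = Vec.tabulate toℕ
      ys = Vec.tabulate λ i → n ℕ.+ toℕ i
      σ-ts : ∀ i → σ (toℕ i) ≡ lookup ts i
      σ-ts = pick-++ˡ (op f ts) ts ss
      σ-ss : ∀ i → σ (n ℕ.+ toℕ i) ≡ lookup ss i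
      σ-ss = pick-++ʳ (op f ts) ts ss
      hyps : All (λ φ → lhs φ [ σ ] ∼[ bound φ ] rhs φ [ σ ]) (varsEq xs ε ys)
      hyps = All.tabulate⁺ λ i → subst₂ (_∼[ ε ]_)
        (≡.sym (≡.trans (cong σ (Vec.lookup∘tabulate toℕ i)) (σ-ts i)))
        (≡.sym (≡.trans (cong σ (Vec.lookup∘tabulate (λ i → n ℕ.+ toℕ i) i)) (σ-ss i)))
        (h i)

    freeDist : Term S ∣ X ∣ → Term S ∣ X ∣ → [0,∞] ℓ
    freeDist t s ._≼_ = t ∼[_] s
    freeDist t s .upper = ∼-weaken
    freeDist t s .closed = continuity

    private
      pseudo : ExtMet ℓ
      pseudo = fromPseudometric (Term S ∣ X ∣) freeDist ∼-refl ∼-sym ∼-trans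

    freeSpace : ExtMet ℓ
    freeSpace .ExtMet.setoid   = ExtMet.setoid pseudo
    freeSpace .ExtMet.d        = ExtMet.d pseudo
    freeSpace .ExtMet.d≃0⇔≈    = ExtMet.d≃0⇔≈ pseudo
    freeSpace .ExtMet.d-sym    = ExtMet.d-sym pseudo
    freeSpace .ExtMet.triangle = ExtMet.triangle pseudo

    free : QuantAlgebra S
    free .QuantAlgebra.space = freeSpace
    free .QuantAlgebra.interp = op
    free .QuantAlgebra.interp-nonExpansive = ∼-op

    unit : NonExpansive X (QuantAlgebra.space free)
    unit ._$_ = var
    unit .nonExpansive _ _ _ = generator

    module _ (A : QuantAlgebra S) (A⊨U : A ⊨* U)
             (h : NonExpansive X (QuantAlgebra.space A)) where
      private module A = QuantAlgebra A

      evaluate-nonExpansive : ∀ t s q → t ∼[ q ] s →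
        A.d (eval A (h $_) t) (eval A (h $_) s) ≼ q
      evaluate-nonExpansive _ _ q (generator x≼q) = nonExpansive h _ _ q x≼q
      evaluate-nonExpansive _ _ q (instantiate {t = t} {s} u σ hs) =
        subst₂ (λ a b → A.d a b ≼ q) (≡.sym (eval-subst A _ σ t)) (≡.sym (eval-subst A _ σ s))
          (A⊨U u (eval A (h $_) ∘ σ) (All.tabulate λ {φ} φ∈Γ →
            subst₂ (λ a b → A.d a b ≼ bound φ)
              (eval-subst A _ σ (lhs φ)) (eval-subst A _ σ (rhs φ))
              (evaluate-nonExpansive _ _ _ (hs φ∈Γ))))
      evaluate-nonExpansive t s q (continuity k) = closed (A.d _ _) λ q′ q<q′ →
        evaluate-nonExpansive t s q′ (k q′ q<q′)

      eval*-map : ∀ {n} (ts : Vec (Term S ∣ X ∣) n) →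
        eval* A (h $_) ts ≡ Vec.map (eval A (h $_)) ts
      eval*-map []       = refl
      eval*-map (t ∷ ts) = cong (_ ∷_) (eval*-map ts)

      evaluate : Homomorphism free A
      evaluate .map ._$_ = eval A (h $_)
      evaluate .map .nonExpansive = evaluate-nonExpansive
      evaluate .homo f ts = A.≈-reflexive (cong (A.interp f) (eval*-map ts))

      -- Stated for an arbitrary map g so that it applies before completing.
      evaluate-unique : (g : Term S ∣ X ∣ → A.Carrier) →
        (∀ x → g (var x) A.≈ h $ x) →
        (∀ f ts → g (op f ts) A.≈ A.interp f (Vec.map g ts)) →
        ∀ t → g t A.≈ eval A (h $_) t
      evaluate-unique g g-var g-op = go
        where
        mutual
          go : ∀ t → g t A.≈ eval A (h $_) t
          go (var x)   = g-var x
          go (op f ts) = A.≈-trans (g-op f ts) (interp-cong A f (go* ts))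

          go* : ∀ {n} (ts : Vec (Term S ∣ X ∣) n) i →
            lookup (Vec.map g ts) i A.≈ lookup (eval* A (h $_) ts) i
          go* (t ∷ ts) zero    = go t
          go* (t ∷ ts) (suc i) = go* ts i

  module _ (B : QuantAlgebra S) where
    private module B = QuantAlgebra B
    private module C = ExtMet (Completion B.space)

    completionAlgebra : QuantAlgebra S
    completionAlgebra .QuantAlgebra.space = Completion B.space
    completionAlgebra .QuantAlgebra.interp f xs .seq n =
      B.interp f (Vec.map (λ x → seq x n) xs)
    completionAlgebra .QuantAlgebra.interp f xs .cauchy {ε} 0<ε =
      let N , N-bound = fin-bounded (arity S f) λ i → proj₁ (cauchy (lookup xs i) 0<ε)
      in N , λ m n N≤m N≤n → B.interp-nonExpansive f _ _ ε λ i →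
        subst₂ (λ a b → B.d a b ≼ ε)
          (≡.sym (Vec.lookup-map i _ xs)) (≡.sym (Vec.lookup-map i _ xs))
          (proj₂ (cauchy (lookup xs i) 0<ε) m n
            (ℕ.≤-trans (N-bound i) N≤m) (ℕ.≤-trans (N-bound i) N≤n))
    completionAlgebra .QuantAlgebra.interp-nonExpansive f xs ys q h q′ q<q′ =
      eventually-map
        (λ n k → B.interp-nonExpansive f _ _ q′ λ i → subst₂ (λ a b → B.d a b ≼ q′)
          (≡.sym (Vec.lookup-map i _ xs)) (≡.sym (Vec.lookup-map i _ ys)) (k i))
        (eventually-all (arity S f) λ i → h i q′ q<q′)

    embed-homo : ∀ f xs → const B.space (B.interp f xs) C.≈
      QuantAlgebra.interp completionAlgebra f (Vec.map (const B.space) xs)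
    embed-homo f xs q′ _ = always λ n → B.≈⇒≼ (B.≈-reflexive (cong (B.interp f)
      (≡.sym (≡.trans (≡.sym (Vec.map-∘ _ _ xs)) (Vec.map-id xs)))))

    module _ (A : QuantAlgebra S) (A-complete : Complete (QuantAlgebra.space A))
             (h : Homomorphism B A) where
      private module A = QuantAlgebra A

      opaque
        lim : CauchySequence B.space → A.Carrier
        lim x = proj₁ (A-complete _ (cauchy-map (map h) (cauchy x)))

        ⟶lim : ∀ x → _⟶_ A.space (λ n → map h $ seq x n) (lim x)
        ⟶lim x = proj₂ (A-complete _ (cauchy-map (map h) (cauchy x)))

      interp-⟶ : ∀ f {x : ℕ → Vec A.Carrier (arity S f)} {l} →
        (∀ i → _⟶_ A.space (λ n → lookup (x n) i) (lookup l i)) →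
        _⟶_ A.space (λ n → A.interp f (x n)) (A.interp f l)
      interp-⟶ f hs {ε} 0<ε = eventually-map (λ n → A.interp-nonExpansive f _ _ ε)
        (eventually-all (arity S f) λ i → hs i 0<ε)

      extendToCompletion : Homomorphism completionAlgebra A
      extendToCompletion .map ._$_ = lim
      extendToCompletion .map .nonExpansive x y q k =
        lim-≼ A.space (⟶lim x) (⟶lim y) λ q′ q<q′ →
          eventually-map (λ n → nonExpansive (map h) _ _ q′) (k q′ q<q′)
      extendToCompletion .homo f xs =
        lim-≈ A.space (⟶lim (QuantAlgebra.interp completionAlgebra f xs))
          (interp-⟶ f {λ n → Vec.map (λ x → map h $ seq x n) xs} λ i {ε} 0<ε →
            eventually-map
              (λ n → subst₂ (λ a b → A.d a b ≼ ε)
                (≡.sym (Vec.lookup-map i _ xs)) (≡.sym (Vec.lookup-map i _ xs)))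
              (⟶lim (lookup xs i) 0<ε))
          λ n → A.≈-trans (homo h f _)
            (A.≈-reflexive (cong (A.interp f) (≡.sym (Vec.map-∘ _ _ xs))))

      extendToCompletion-embed : ∀ x → lim (const B.space x) A.≈ map h $ x
      extendToCompletion-embed x = lim-≈ A.space (⟶lim (const B.space x))
        (λ _ → always λ _ → A.≼-refl) λ _ → A.≈-refl

      extendToCompletion-unique : (g : NonExpansive (Completion B.space) A.space) →
        (∀ x → g $ const B.space x A.≈ map h $ x) → ∀ x → g $ x A.≈ lim x
      extendToCompletion-unique g g-embed x =
        lim-≈ A.space (lim-map g (embed-⟶ B.space x)) (⟶lim x) λ n → g-embed (seq x n)

record Category o ℓ e : Set (Level.suc (o ⊔ ℓ ⊔ e)) where
  no-eta-equality
  infix 4 _≋_ _⇒_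
  infixr 9 _∙_
  field
    Obj  : Set o
    _⇒_  : Rel Obj ℓ
    _≋_  : ∀ {A B} → Rel (A ⇒ B) e
    idₘ  : ∀ {A} → A ⇒ A
    _∙_  : ∀ {A B C} → B ⇒ C → A ⇒ B → A ⇒ C
    ≋-isEquivalence : ∀ {A B} → IsEquivalence (_≋_ {A} {B})
    ∙-assoc     : ∀ {A B C D} (h : C ⇒ D) (g : B ⇒ C) (f : A ⇒ B) →
      (h ∙ g) ∙ f ≋ h ∙ (g ∙ f)
    ∙-identityˡ : ∀ {A B} (f : A ⇒ B) → idₘ ∙ f ≋ f
    ∙-identityʳ : ∀ {A B} (f : A ⇒ B) → f ∙ idₘ ≋ f
    ∙-cong      : ∀ {A B C} {g g′ : B ⇒ C} {f f′ : A ⇒ B} →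
      g ≋ g′ → f ≋ f′ → g ∙ f ≋ g′ ∙ f′

  hom : Obj → Obj → Setoid ℓ e
  hom A B = record { isEquivalence = ≋-isEquivalence {A} {B} }

record Functor {o ℓ e o′ ℓ′ e′} (C : Category o ℓ e) (D : Category o′ ℓ′ e′)
    : Set (o ⊔ ℓ ⊔ e ⊔ o′ ⊔ ℓ′ ⊔ e′) where
  no-eta-equality
  private module C = Category C
  private module D = Category D
  field
    F₀     : C.Obj → D.Obj
    F₁     : ∀ {A B} → A C.⇒ B → F₀ A D.⇒ F₀ B
    F-cong : ∀ {A B} {f g : A C.⇒ B} → f C.≋ g → F₁ f D.≋ F₁ g
    F-id   : ∀ {A} → F₁ (C.idₘ {A}) D.≋ D.idₘ
    F-∙    : ∀ {A B E} (g : B C.⇒ E) (f : A C.⇒ B) → F₁ (g C.∙ f) D.≋ F₁ g D.∙ F₁ f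

open Functor

infixr 9 _∘F_
_∘F_ : ∀ {o ℓ e o′ ℓ′ e′ o″ ℓ″ e″} {C : Category o ℓ e} {D : Category o′ ℓ′ e′}
  {E : Category o″ ℓ″ e″} → Functor D E → Functor C D → Functor C E
(G ∘F F) .F₀ X = G .F₀ (F .F₀ X)
(G ∘F F) .F₁ f = G .F₁ (F .F₁ f)
(G ∘F F) .F-cong f≋g = G .F-cong (F .F-cong f≋g)
_∘F_ {E = E} G F .F-id =
  IsEquivalence.trans (Category.≋-isEquivalence E) (G .F-cong (F .F-id)) (G .F-id)
_∘F_ {E = E} G F .F-∙ g f = IsEquivalence.trans (Category.≋-isEquivalence E)
  (G .F-cong (F .F-∙ g f)) (G .F-∙ (F .F₁ g) (F .F₁ f))

record Monad {o ℓ e} (C : Category o ℓ e) : Set (o ⊔ ℓ ⊔ e) where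
  no-eta-equality
  open Category C
  field
    functor : Functor C C
  open Functor functor public renaming (F₀ to T₀; F₁ to T₁)
  field
    η : ∀ X → X ⇒ T₀ X
    μ : ∀ X → T₀ (T₀ X) ⇒ T₀ X
    η-natural : ∀ {X Y} (f : X ⇒ Y) → η Y ∙ f ≋ T₁ f ∙ η X
    μ-natural : ∀ {X Y} (f : X ⇒ Y) → μ Y ∙ T₁ (T₁ f) ≋ T₁ f ∙ μ X
    μ-η       : ∀ X → μ X ∙ η (T₀ X) ≋ idₘ
    μ-Tη      : ∀ X → μ X ∙ T₁ (η X) ≋ idₘ
    μ-μ       : ∀ X → μ X ∙ μ (T₀ X) ≋ μ X ∙ T₁ (μ X)

infix 4 _≅_

record _≅_ {o ℓ e} {C : Category o ℓ e} (S T : Monad C) : Set (o ⊔ ℓ ⊔ e) where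
  open Category C
  private module S = Monad S
  private module T = Monad T
  field
    to      : ∀ X → S.T₀ X ⇒ T.T₀ X
    from    : ∀ X → T.T₀ X ⇒ S.T₀ X
    to∙from : ∀ X → to X ∙ from X ≋ idₘ
    from∙to : ∀ X → from X ∙ to X ≋ idₘ
    natural : ∀ {X Y} (f : X ⇒ Y) → to Y ∙ S.T₁ f ≋ T.T₁ f ∙ to X
    to-η    : ∀ X → to X ∙ S.η X ≋ T.η X
    to-μ    : ∀ X → to X ∙ S.μ X ≋ T.μ X ∙ (T.T₁ (to X) ∙ to (S.T₀ X))

-- A left adjoint of U, given by a universal arrow from each object of C to U.
record LeftAdjoint {o ℓ e o′ ℓ′ e′} {C : Category o ℓ e} {D : Category o′ ℓ′ e′}
    (U : Functor D C) : Set (o ⊔ ℓ ⊔ e ⊔ o′ ⊔ ℓ′ ⊔ e′) where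
  no-eta-equality
  private module C = Category C
  private module D = Category D
  private module U = Functor U
  field
    L₀     : C.Obj → D.Obj
    η      : ∀ X → X C.⇒ U.F₀ (L₀ X)
    extend : ∀ {X A} → X C.⇒ U.F₀ A → L₀ X D.⇒ A
    extend-η : ∀ {X A} (f : X C.⇒ U.F₀ A) → U.F₁ (extend f) C.∙ η X C.≋ f
    unique   : ∀ {X A} (f : X C.⇒ U.F₀ A) (g : L₀ X D.⇒ A) →
      U.F₁ g C.∙ η X C.≋ f → g D.≋ extend f

  private
    module ≋ᴰ {A B} = IsEquivalence (D.≋-isEquivalence {A} {B})
    module ≋ᶜ {A B} = IsEquivalence (C.≋-isEquivalence {A} {B})

  jointly-monic : ∀ {X A} (g h : L₀ X D.⇒ A) →
    U.F₁ g C.∙ η X C.≋ U.F₁ h C.∙ η X → g D.≋ h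
  jointly-monic g h eq = ≋ᴰ.trans (unique _ g eq) (≋ᴰ.sym (unique _ h ≋ᶜ.refl))

  extend-∙ : ∀ {X A B} (h : A D.⇒ B) (f : X C.⇒ U.F₀ A) →
    extend (U.F₁ h C.∙ f) D.≋ h D.∙ extend f
  extend-∙ {X} h f = ≋ᴰ.sym (unique _ _ (begin
    U.F₁ (h D.∙ extend f) C.∙ η X         ≈⟨ C.∙-cong (U.F-∙ h (extend f)) ≋ᶜ.refl ⟩
    (U.F₁ h C.∙ U.F₁ (extend f)) C.∙ η X  ≈⟨ C.∙-assoc _ _ _ ⟩
    U.F₁ h C.∙ (U.F₁ (extend f) C.∙ η X)  ≈⟨ C.∙-cong ≋ᶜ.refl (extend-η f) ⟩
    U.F₁ h C.∙ f                          ∎))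
    where open import Relation.Binary.Reasoning.Setoid (C.hom _ _)

  extend-cong : ∀ {X A} {f g : X C.⇒ U.F₀ A} → f C.≋ g → extend f D.≋ extend g
  extend-cong {f = f} {g} f≋g = unique g (extend f) (≋ᶜ.trans (extend-η f) f≋g)

  ε : ∀ A → L₀ (U.F₀ A) D.⇒ A
  ε A = extend C.idₘ

  L₁ : ∀ {X Y} → X C.⇒ Y → L₀ X D.⇒ L₀ Y
  L₁ {Y = Y} f = extend (η Y C.∙ f)

  extend-∙-L₁ : ∀ {X Y A} (g : Y C.⇒ U.F₀ A) (f : X C.⇒ Y) →
    extend g D.∙ L₁ f D.≋ extend (g C.∙ f)
  extend-∙-L₁ {Y = Y} g f = ≋ᴰ.trans (≋ᴰ.sym (extend-∙ (extend g) (η Y C.∙ f)))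
    (extend-cong (≋ᶜ.trans (≋ᶜ.sym (C.∙-assoc _ _ _)) (C.∙-cong (extend-η g) ≋ᶜ.refl)))

  extend-as-ε : ∀ {X A} (f : X C.⇒ U.F₀ A) → ε A D.∙ L₁ f D.≋ extend f
  extend-as-ε f = ≋ᴰ.trans (extend-∙-L₁ C.idₘ f) (extend-cong (C.∙-identityˡ f))

  ε-∙ : ∀ {A B} (h : A D.⇒ B) → extend (U.F₁ h) D.≋ h D.∙ ε A
  ε-∙ h = ≋ᴰ.trans (extend-cong (≋ᶜ.sym (C.∙-identityʳ _))) (extend-∙ h C.idₘ)

  extend-η-id : ∀ {X} → extend (η X) D.≋ D.idₘ
  extend-η-id {X} = ≋ᴰ.sym (unique (η X) D.idₘ
    (≋ᶜ.trans (C.∙-cong U.F-id ≋ᶜ.refl) (C.∙-identityˡ _)))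

  left : Functor C D
  left .F₀ = L₀
  left .F₁ = L₁
  left .F-cong f≋g = extend-cong (C.∙-cong ≋ᶜ.refl f≋g)
  left .F-id = ≋ᴰ.trans (extend-cong (C.∙-identityʳ _)) extend-η-id
  left .F-∙ g f = ≋ᴰ.sym (≋ᴰ.trans (extend-∙-L₁ (η _ C.∙ g) f)
               (extend-cong (C.∙-assoc _ _ _)))

  U-square : ∀ {A B B′ E} {g : B D.⇒ E} {f : A D.⇒ B} {g′ : B′ D.⇒ E} {f′ : A D.⇒ B′} →
    g D.∙ f D.≋ g′ D.∙ f′ → U.F₁ g C.∙ U.F₁ f C.≋ U.F₁ g′ C.∙ U.F₁ f′
  U-square eq = ≋ᶜ.trans (≋ᶜ.sym (U.F-∙ _ _)) (≋ᶜ.trans (U.F-cong eq) (U.F-∙ _ _))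

  inducedMonad : Monad C
  inducedMonad .Monad.functor = U ∘F left
  inducedMonad .Monad.η = η
  inducedMonad .Monad.μ X = U.F₁ (ε (L₀ X))
  inducedMonad .Monad.η-natural f = ≋ᶜ.sym (extend-η _)
  inducedMonad .Monad.μ-natural f =
    U-square (≋ᴰ.trans (extend-as-ε (U.F₁ (L₁ f))) (ε-∙ (L₁ f)))
  inducedMonad .Monad.μ-η X = extend-η C.idₘ
  inducedMonad .Monad.μ-Tη X = ≋ᶜ.trans (≋ᶜ.sym (U.F-∙ _ _))
      (≋ᶜ.trans (U.F-cong (≋ᴰ.trans (extend-as-ε (η X)) extend-η-id)) U.F-id)
  inducedMonad .Monad.μ-μ X = U-square (≋ᴰ.trans (≋ᴰ.sym (ε-∙ (ε (L₀ X))))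
      (≋ᴰ.sym (extend-as-ε (U.F₁ (ε (L₀ X))))))

FullSubcategory : ∀ {i o ℓ e} (C : Category o ℓ e) {I : Set i} →
  (I → Category.Obj C) → Category i ℓ e
FullSubcategory C {I} obj .Category.Obj = I
FullSubcategory C {I} obj .Category._⇒_ A B = Category._⇒_ C (obj A) (obj B)
FullSubcategory C {I} obj .Category._≋_ = Category._≋_ C
FullSubcategory C {I} obj .Category.idₘ = Category.idₘ C
FullSubcategory C {I} obj .Category._∙_ = Category._∙_ C
FullSubcategory C {I} obj .Category.≋-isEquivalence = Category.≋-isEquivalence C
FullSubcategory C {I} obj .Category.∙-assoc = Category.∙-assoc C
FullSubcategory C {I} obj .Category.∙-identityˡ = Category.∙-identityˡ C
FullSubcategory C {I} obj .Category.∙-identityʳ = Category.∙-identityʳ C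
FullSubcategory C {I} obj .Category.∙-cong = Category.∙-cong C

module _ {ℓ : Level} {X Y : ExtMet ℓ} where
  open ExtMet Y

  infix 4 _≐_
  _≐_ : Rel (NonExpansive X Y) ℓ
  f ≐ g = ∀ x → f $ x ≈ g $ x

  ≐-isEquivalence : IsEquivalence _≐_
  ≐-isEquivalence = record
    { refl = λ _ → ≈-refl ; sym = λ h x → ≈-sym (h x) ; trans = λ h k x → ≈-trans (h x) (k x) }

idₙ : ∀ {ℓ} {X : ExtMet ℓ} → NonExpansive X X
idₙ ._$_ x = x
idₙ .nonExpansive _ _ _ h = h

infixr 9 _∘ₙ_
_∘ₙ_ : ∀ {ℓ} {X Y Z : ExtMet ℓ} → NonExpansive Y Z → NonExpansive X Y → NonExpansive X Z
(g ∘ₙ f) ._$_ x = g $ (f $ x)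
(g ∘ₙ f) .nonExpansive x x′ q h = nonExpansive g _ _ q (nonExpansive f x x′ q h)

Met : ∀ ℓ → Category (Level.suc ℓ) ℓ ℓ
Met ℓ .Category.Obj = ExtMet ℓ
Met ℓ .Category._⇒_ = NonExpansive
Met ℓ .Category._≋_ = _≐_
Met ℓ .Category.idₘ = idₙ
Met ℓ .Category._∙_ = _∘ₙ_
Met ℓ .Category.≋-isEquivalence = ≐-isEquivalence
Met ℓ .Category.∙-assoc {_} {_} {_} {D} _ _ _ _ = ExtMet.≈-refl D
Met ℓ .Category.∙-identityˡ {_} {B} _ _ = ExtMet.≈-refl B
Met ℓ .Category.∙-identityʳ {_} {B} _ _ = ExtMet.≈-refl B
Met ℓ .Category.∙-cong {_} {_} {C} {g} {g′} {f} {f′} g≐g′ f≐f′ x =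
    ExtMet.≈-trans C (resp-≈ g (f≐f′ x)) (g≐g′ (f′ $ x))

CompleteExtMet : ∀ ℓ → Set (Level.suc ℓ)
CompleteExtMet ℓ = Σ (ExtMet ℓ) Complete

CMet : ∀ ℓ → Category (Level.suc ℓ) ℓ ℓ
CMet ℓ = FullSubcategory (Met ℓ) {CompleteExtMet ℓ} proj₁

module _ {ℓ : Level} (S : Signature ℓ) where

  QAlg : Category (Level.suc ℓ) ℓ ℓ
  QAlg .Category.Obj = QuantAlgebra S
  QAlg .Category._⇒_ = Homomorphism
  QAlg .Category._≋_ f g = map f ≐ map g
  QAlg .Category.idₘ .map = idₙ
  QAlg .Category.idₘ {A} .homo f xs = QuantAlgebra.≈-reflexive A
    (cong (QuantAlgebra.interp A f) (≡.sym (Vec.map-id xs)))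
  QAlg .Category._∙_ g f .map = map g ∘ₙ map f
  QAlg .Category._∙_ {_} {_} {C} g f .homo o xs =
    C.≈-trans (resp-≈ (map g) (homo f o xs)) (C.≈-trans (homo g o _)
      (C.≈-reflexive (cong (C.interp o) (≡.sym (Vec.map-∘ _ _ xs)))))
    where module C = QuantAlgebra C
  QAlg .Category.≋-isEquivalence {A} {B} = record
      { refl  = λ _ → QuantAlgebra.≈-refl B
      ; sym   = λ h x → QuantAlgebra.≈-sym B (h x)
      ; trans = λ h k x → QuantAlgebra.≈-trans B (h x) (k x)
      }
  QAlg .Category.∙-assoc {_} {_} {_} {D} _ _ _ _ = QuantAlgebra.≈-refl D
  QAlg .Category.∙-identityˡ {_} {B} _ _ = QuantAlgebra.≈-refl B
  QAlg .Category.∙-identityʳ {_} {B} _ _ = QuantAlgebra.≈-refl B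
  QAlg .Category.∙-cong {_} {_} {C} {g} {g′} {f} {f′} g≐g′ f≐f′ x =
      QuantAlgebra.≈-trans C (resp-≈ (map g) (f≐f′ x)) (g≐g′ (map f′ $ x))

  module _ (U : Pred (CondQuantEq S) ℓ) where

    record CompleteModel : Set (Level.suc ℓ) where
      no-eta-equality
      field
        algebra  : QuantAlgebra S
        complete : Complete (QuantAlgebra.space algebra)
        models   : algebra ⊨* U
    open CompleteModel

    ℂ𝕂 : Category (Level.suc ℓ) ℓ ℓ
    ℂ𝕂 = FullSubcategory QAlg {CompleteModel} algebra

    forgetful : Functor ℂ𝕂 (CMet ℓ)
    forgetful .F₀ A = QuantAlgebra.space (algebra A) , complete A
    forgetful .F₁ = map
    forgetful .F-cong = id
    forgetful .F-id {A} _ = QuantAlgebra.≈-refl (algebra A)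
    forgetful .F-∙ {_} {_} {C} _ _ _ = QuantAlgebra.≈-refl (algebra C)

  -- The property of continuous theories through which the Cauchy completion of a free
  -- algebra is again a model.
  ClosedUnderCompletion : Pred (CondQuantEq S) ℓ → Set (Level.suc ℓ)
  ClosedUnderCompletion U = ∀ (A : QuantAlgebra S) → A ⊨* U → completionAlgebra A ⊨* U

module _ {ℓ : Level} {S : Signature ℓ} {U : Pred (CondQuantEq S) ℓ}
         (T : IsTheory U) (continuous : ClosedUnderCompletion S U) where
  open CompleteModel

  opaque
    free-models : ∀ X → FreeAlgebra.free T X ⊨* U
    free-models X {Γ ⊢ t =[ ε ] s} u ι hs =
      subst₂ (_∼[ ε ]_) (eval-is-subst t) (eval-is-subst s)
        (instantiate u ι λ {φ} φ∈Γ →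
          subst₂ (_∼[ bound φ ]_) (≡.sym (eval-is-subst (lhs φ))) (≡.sym (eval-is-subst (rhs φ)))
            (All.lookup hs φ∈Γ))
      where
      open FreeAlgebra T X
      mutual
        eval-is-subst : ∀ t → t [ ι ] ≡ eval free ι t
        eval-is-subst (var x)   = refl
        eval-is-subst (op f ts) = cong (op f) (eval*-is-subst ts)

        eval*-is-subst : ∀ {n} (ts : Vec (Term S V) n) → ts [ ι ]* ≡ eval* free ι ts
        eval*-is-subst []       = refl
        eval*-is-subst (t ∷ ts) = cong₂ _∷_ (eval-is-subst t) (eval*-is-subst ts)

  freeCompleteModel : CompleteExtMet ℓ → CompleteModel S U
  freeCompleteModel (X , _) .algebra = completionAlgebra (FreeAlgebra.free T X)
  freeCompleteModel (X , _) .complete =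
    completion-complete (QuantAlgebra.space (FreeAlgebra.free T X))
  freeCompleteModel (X , _) .models = continuous (FreeAlgebra.free T X) (free-models X)

  private module F = FreeAlgebra T

  point : ∀ X → Term S ∣ X ∣ → CauchySequence (QuantAlgebra.space (F.free X))
  point X = const (QuantAlgebra.space (F.free X))

  evaluation : ∀ X (A : CompleteModel S U) → NonExpansive X (QuantAlgebra.space (algebra A)) →
    Homomorphism (F.free X) (algebra A)
  evaluation X A = F.evaluate X (algebra A) (models A)

  embed-op-homo : ∀ X (A : CompleteModel S U)
    (g : Homomorphism (completionAlgebra (F.free X)) (algebra A)) f ts →
    QuantAlgebra._≈_ (algebra A) (map g $ point X (op f ts))
      (QuantAlgebra.interp (algebra A) f (Vec.map (λ t → map g $ point X t) ts))
  embed-op-homo X A g f ts = A.≈-trans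
    (resp-≈ (map g) {point X (op f ts)}
      {QuantAlgebra.interp (completionAlgebra (F.free X)) f (Vec.map (point X) ts)}
      (embed-homo (F.free X) f ts))
    (A.≈-trans (homo g f (Vec.map (point X) ts))
      (A.≈-reflexive (cong (A.interp f) (≡.sym (Vec.map-∘ (map g $_) (point X) ts)))))
    where module A = QuantAlgebra (algebra A)

  completeFree : LeftAdjoint (forgetful S U)
  completeFree .LeftAdjoint.L₀ = freeCompleteModel
  completeFree .LeftAdjoint.η (X , _) = embed (QuantAlgebra.space (F.free X)) ∘ₙ F.unit X
  completeFree .LeftAdjoint.extend {(X , _)} {A} f =
      extendToCompletion (F.free X) (algebra A) (complete A) (evaluation X A f)
  completeFree .LeftAdjoint.extend-η {(X , _)} {A} f x =
      extendToCompletion-embed (F.free X) (algebra A) (complete A) (evaluation X A f) (var x)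
  completeFree .LeftAdjoint.unique {(X , _)} {A} f g g-η =
      extendToCompletion-unique (F.free X) (algebra A) (complete A) (evaluation X A f) (map g)
        (F.evaluate-unique X (algebra A) (models A) f
          (λ t → map g $ point X t) g-η (embed-op-homo X A g))

  ℂT : Monad (CMet ℓ)
  ℂT = LeftAdjoint.inducedMonad completeFree

record CompleteMetricMonoid ℓ : Set (Level.suc ℓ) where
  no-eta-equality
  infixl 7 _*_
  field
    space    : ExtMet ℓ
    complete : Complete space
  open ExtMet space public
  field
    _*_      : Carrier → Carrier → Carrier
    𝟘        : Carrier
    isMonoid : IsMonoid _≈_ _*_ 𝟘
    *-nonExpansive : ∀ α β α′ β′ → d (α * β) (α′ * β′) ≤∞ d α α′ +∞ d β β′

module _ {ℓ : Level} (Λ : CompleteMetricMonoid ℓ) where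
  open CompleteMetricMonoid Λ hiding (≼-refl; ≼-sym; ≼-trans; ≼-upper)
  open IsMonoid isMonoid using (assoc; identityˡ; identityʳ)

  writerSignature : Signature ℓ
  writerSignature = record { Op = Carrier ; arity = λ _ → 1 }

  𝗐 : ∀ {x} {X : Set x} → Carrier → Term writerSignature X → Term writerSignature X
  𝗐 α t = op α (t ∷ [])

  data WriterAxioms : Pred (CondQuantEq writerSignature) ℓ where
    w-zero     : ∀ x → WriterAxioms ([] ⊢ var x =[ 0# ] 𝗐 𝟘 (var x))
    w-multiply : ∀ α α′ x →
      WriterAxioms ([] ⊢ 𝗐 α (𝗐 α′ (var x)) =[ 0# ] 𝗐 (α * α′) (var x))
    w-distance : ∀ α α′ x x′ ε δ → d α α′ +∞ ⌈ ε ⌉ ≤∞ ⌈ δ ⌉ →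
      WriterAxioms (var x =[ ε ] var x′ ∷ [] ⊢ 𝗐 α (var x) =[ δ ] 𝗐 α′ (var x′))

  𝒲 : Pred (CondQuantEq writerSignature) ℓ
  𝒲 = Axiomatized WriterAxioms

  𝒲-isTheory : IsTheory 𝒲
  𝒲-isTheory = axiomatized-isTheory WriterAxioms

  opaque
    𝒲-continuous : ClosedUnderCompletion writerSignature 𝒲
    𝒲-continuous A A⊨𝒲 =
      axiomatized-smallest (models-isTheory (completionAlgebra A)) λ
        { {_} (w-zero x) ι _ q′ _ → always λ n →
            A.≼-upper 0≤ (A⊨𝒲 (axiom (w-zero x)) (λ v → seq (ι v) n) [])
        ; {_} (w-multiply α α′ x) ι _ q′ _ → always λ n →
            A.≼-upper 0≤ (A⊨𝒲 (axiom (w-multiply α α′ x)) (λ v → seq (ι v) n) [])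
        ; {_} (w-distance α α′ x x′ ε δ h) ι (k ∷ []) δ′ δ<δ′ →
            let γ , 0<γ , δ+γ≡δ′ = ∃-difference δ<δ′ in
            eventually-map
              (λ n k′ → subst (A.d _ _ ≼_) δ+γ≡δ′
                (A⊨𝒲 (axiom (w-distance α α′ x x′ (ε + γ) (δ + γ) (shift {d α α′} h)))
                  (λ v → seq (ι v) n) (k′ ∷ [])))
              (k (ε + γ) (p<p+ε 0<γ))
        }
      where
      module A = QuantAlgebra A
      shift : ∀ {r : [0,∞] ℓ} {ε δ γ} → r +∞ ⌈ ε ⌉ ≤∞ ⌈ δ ⌉ → r +∞ ⌈ ε + γ ⌉ ≤∞ ⌈ δ + γ ⌉
      shift {r} {ε} {δ} {γ} h q (lift δ+γ≤q) = upper (r +∞ ⌈ ε + γ ⌉) δ+γ≤q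
        (closed⁺ (r +∞ ⌈ ε + γ ⌉) λ {η} 0<η →
          let a , b , r≼a , lift ε≤b , a+b≤δ+η = h δ (lift ≤-refl) (δ + η) (p<p+ε 0<η) in
          upper (r +∞ ⌈ ε + γ ⌉)
            (subst₂ _≤_ (+-assoc a b γ)
              (≡.trans (+-assoc δ η γ)
                (≡.trans (cong (δ +_) (+-comm η γ)) (≡.sym (+-assoc δ γ η))))
              (+-mono-≤ a+b≤δ+η ≤-refl))
            (+∞-intro r ⌈ ε + γ ⌉ r≼a (lift (+-mono-≤ ε≤b ≤-refl))))

  ℂT𝒲 : Monad (CMet ℓ)
  ℂT𝒲 = ℂT 𝒲-isTheory 𝒲-continuous

  Λ□_ : CompleteExtMet ℓ → CompleteExtMet ℓ
  Λ□ (X , X-complete) = space □ X , □-complete {X = space} {X} complete X-complete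

  Λ□₁ : ∀ (X Y : ExtMet ℓ) → NonExpansive X Y → NonExpansive (space □ X) (space □ Y)
  Λ□₁ X Y f ._$_ (α , x) = α , f $ x
  Λ□₁ X Y f .nonExpansive _ _ q h q′ q<q′ =
    let a , b , h₁ , h₂ , le = h q′ q<q′ in a , b , h₁ , nonExpansive f _ _ b h₂ , le

  τ : ∀ (X : ExtMet ℓ) → NonExpansive X (space □ X)
  τ X ._$_ x = 𝟘 , x
  τ X .nonExpansive x x′ q h = subst (ExtMet.d (space □ X) (𝟘 , x) (𝟘 , x′) ≼_)
    (+-identityˡ q) (+∞-intro (d 𝟘 𝟘) (ExtMet.d X x x′) (≈⇒≼ ≈-refl) h)

  ς : ∀ (X : ExtMet ℓ) → NonExpansive (space □ (space □ X)) (space □ X)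
  ς X ._$_ (α , α′ , x) = α * α′ , x
  ς X .nonExpansive (α , β , x) (α′ , β′ , x′) =
    ≤∞-+∞ (D.d (α * β , x) (α′ * β′ , x′)) (d α α′) (D.d (β , x) (β′ , x′))
      λ {a} {b} h k → closed⁺ (D.d (α * β , x) (α′ * β′ , x′)) λ {ε} 0<ε →
        let b₁ , b₂ , k₁ , k₂ , le = k (b + ε) (p<p+ε 0<ε)
        in upper (D.d (α * β , x) (α′ * β′ , x′))
             (subst₂ _≤_ (≡.sym (+-assoc a b₁ b₂)) (≡.sym (+-assoc a b ε))
               (+-mono-≤ ≤-refl le))
             (+∞-intro (d _ _) (ExtMet.d X x x′)
               (*-nonExpansive α β α′ β′ _ (+∞-intro (d α α′) (d β β′) h k₁)) k₂)
    where module D = ExtMet (space □ X)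

  Λ□-functor : Functor (CMet ℓ) (CMet ℓ)
  Λ□-functor .F₀ = Λ□_
  Λ□-functor .F₁ {(X , _)} {(Y , _)} = Λ□₁ X Y
  Λ□-functor .F-cong f≐g (α , x) = ≈-refl , f≐g x
  Λ□-functor .F-id {X} _ = ≈-refl , ExtMet.≈-refl (proj₁ X)
  Λ□-functor .F-∙ {_} {_} {Z} _ _ _ = ≈-refl , ExtMet.≈-refl (proj₁ Z)

  Writer : Monad (CMet ℓ)
  Writer .Monad.functor = Λ□-functor
  Writer .Monad.η (X , _) = τ X
  Writer .Monad.μ (X , _) = ς X
  Writer .Monad.η-natural {_} {Y} _ _ = ≈-refl , ExtMet.≈-refl (proj₁ Y)
  Writer .Monad.μ-natural {_} {Y} _ _ = ≈-refl , ExtMet.≈-refl (proj₁ Y)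
  Writer .Monad.μ-η (X , _) (α , x) = identityˡ α , ExtMet.≈-refl X
  Writer .Monad.μ-Tη (X , _) (α , x) = identityʳ α , ExtMet.≈-refl X
  Writer .Monad.μ-μ (X , _) (α , β , γ , x) = assoc α β γ , ExtMet.≈-refl X

{-# OPTIONS --safe #-}
module Submission where

-- Λ □ X is itself a complete model of 𝒲, with 𝗐 α acting by left multiplication,
-- and every non-expansive f : X → A into a complete model extends to the
-- homomorphism (α , x) ↦ 𝗐 α (f x) on Λ □ X.  So Λ □ X is free over X with unit τ,
-- and every equation between the two monads is an equation between homomorphisms
-- out of a free model, hence can be checked on generators.

open import Defs
open import Level using (Level; lift)
open import Data.Nat using (zero; suc)
open import Data.Product using (_,_; proj₁; proj₂)
open import Data.Vec using ([]; _∷_)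
open import Data.Fin using () renaming (zero to fzero)
open import Data.List.Relation.Unary.All using ([]; _∷_)
open import Algebra.Structures using (IsMonoid)
open NonExpansive using (_$_; nonExpansive; resp-≈)
open Homomorphism using (map; homo)
open CompleteModel using (algebra; complete; models)
open [0,∞] using (_≼_; upper)

module _ {ℓ : Level} (Λ : CompleteMetricMonoid ℓ) where
  private
    module Λ = CompleteMetricMonoid Λ
    module M = IsMonoid Λ.isMonoid
    S : Signature ℓ
    S = writerSignature Λ
    Free : LeftAdjoint (forgetful S (𝒲 Λ))
    Free = completeFree (𝒲-isTheory Λ) (𝒲-continuous Λ)
    module Free = LeftAdjoint Free

  writerAlgebra : ExtMet ℓ → QuantAlgebra S
  writerAlgebra X .QuantAlgebra.space = Λ.space □ X
  writerAlgebra X .QuantAlgebra.interp α (u ∷ []) = ς Λ X $ (α , u)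
  writerAlgebra X .QuantAlgebra.interp-nonExpansive α (u ∷ []) (v ∷ []) q h =
    -- Acting by `α` is pairing with `α` followed by `ς`, and both maps are non-expansive.
    nonExpansive (ς Λ X) (α , u) (α , v) q
      (nonExpansive (pair-with α) u v q (h fzero))
    where
    pair-with : ∀ α → NonExpansive (Λ.space □ X) (Λ.space □ (Λ.space □ X))
    pair-with α ._$_ w = α , w
    pair-with α .nonExpansive w w′ q h q′ q<q′ =
      -- All of `q′` goes to the second coordinate, as the first coordinates coincide.
      0# , q′ , Λ.≼-refl , upper (□.d Λ.space X w w′) (<⇒≤ q<q′) h ,
      ≤-reflexive (+-identityˡ q′)

  -- What an algebra satisfies is a theory, so the axioms suffice: they are the left unit law,
  -- associativity and non-expansiveness of `ς`.
  writerAlgebra-models : ∀ X → writerAlgebra X ⊨* 𝒲 Λ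
  writerAlgebra-models X = axiomatized-smallest (models-isTheory (writerAlgebra X)) λ
    { {_} (w-zero x) ι [] → W.≈⇒≼ (Λ.≈-sym (M.identityˡ _) , X.≈-refl)
    ; {_} (w-multiply α α′ x) ι [] → W.≈⇒≼ (Λ.≈-sym (M.assoc α α′ _) , X.≈-refl)
    ; {_} (w-distance α α′ x x′ ε δ h) ι (k ∷ []) →
        nonExpansive (ς Λ X) (α , ι x) (α′ , ι x′) δ λ q′ δ<q′ →
          -- The side condition of the axiom, taken at `δ` itself, supplies the splitting of each
          -- `q′` above `δ` that the sum metric asks for.
          let a , b , α≼a , lift ε≤b , a+b≤q′ = h δ (lift ≤-refl) q′ δ<q′
          in a , b , α≼a , upper (W.d (ι x) (ι x′)) ε≤b k , a+b≤q′
    }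
    where
    module W = QuantAlgebra (writerAlgebra X)
    module X = ExtMet X

  writerModel : CompleteExtMet ℓ → CompleteModel S (𝒲 Λ)
  writerModel (X , _) .algebra = writerAlgebra X
  writerModel X .complete = proj₂ ((Λ□ Λ) X)
  writerModel (X , _) .models = writerAlgebra-models X

  module _ (A : QuantAlgebra S) (A⊨𝒲 : A ⊨* 𝒲 Λ) where
    private module A = QuantAlgebra A

    interp-zero : ∀ a → A.interp Λ.𝟘 (a ∷ []) A.≈ a
    interp-zero a = A.≈-sym (A.≼0⇒≈ (A⊨𝒲 (axiom (w-zero 0)) (λ _ → a) []))

    interp-multiply : ∀ α β a →
      A.interp (α Λ.* β) (a ∷ []) A.≈ A.interp α (A.interp β (a ∷ []) ∷ [])
    interp-multiply α β a =
      A.≈-sym (A.≼0⇒≈ (A⊨𝒲 (axiom (w-multiply α β 0)) (λ _ → a) []))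

    -- This is the distance axiom with `ε` taken as `q` and `δ` as `p + q`; the bound `h` yields its
    -- side condition.
    interp-distance : ∀ {α β a b p q} → Λ.d α β ≼ p → A.d a b ≼ q →
      A.d (A.interp α (a ∷ [])) (A.interp β (b ∷ [])) ≼ p + q
    interp-distance {α} {β} {a} {b} {p} {q} h k =
      A⊨𝒲 (axiom (w-distance α β 0 1 q (p + q) λ r (lift p+q≤r) →
            upper (Λ.d α β +∞ ⌈ q ⌉) p+q≤r (+∞-intro (Λ.d α β) ⌈ q ⌉ h (lift ≤-refl))))
        (λ { zero → a ; (suc _) → b }) (k ∷ [])

    -- The distance axiom makes the map non-expansive and the multiplication axiom makes it a
    -- homomorphism.
    evaluateWriter : ∀ X → NonExpansive X A.space → Homomorphism (writerAlgebra X) A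
    evaluateWriter X f .map ._$_ (α , x) = A.interp α (f $ x ∷ [])
    evaluateWriter X f .map .nonExpansive (α , x) (β , y) =
      ≤∞-+∞ (A.d _ _) (Λ.d α β) (ExtMet.d X x y) λ h k →
        interp-distance h (nonExpansive f x y _ k)
    evaluateWriter X f .homo α ((β , x) ∷ []) = interp-multiply α β (f $ x)

  Λ□₁-hom : ∀ X Y → NonExpansive X Y → Homomorphism (writerAlgebra X) (writerAlgebra Y)
  Λ□₁-hom X Y f .map = Λ□₁ Λ X Y f
  Λ□₁-hom X Y f .homo α (_ ∷ []) = Λ.≈-refl , ExtMet.≈-refl Y

  -- Associativity of `*` makes `ς` commute with left multiplication, so that the law for
  -- multiplications can be tested on generators.
  ς-hom : ∀ X → Homomorphism (writerAlgebra (Λ.space □ X)) (writerAlgebra X)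
  ς-hom X .map = ς Λ X
  ς-hom X .homo α ((β , γ , _) ∷ []) = M.assoc α β γ , ExtMet.≈-refl X

  private
    open Category (QAlg S) using (_∙_; idₘ)
    open Category (ℂ𝕂 S (𝒲 Λ)) using (_⇒_)

    toWriter : ∀ X → Free.L₀ X ⇒ writerModel X
    toWriter X = Free.extend {X} {writerModel X} (τ Λ (proj₁ X))

    fromWriter : ∀ X → writerModel X ⇒ Free.L₀ X
    fromWriter X =
      evaluateWriter (algebra (Free.L₀ X)) (models (Free.L₀ X)) (proj₁ X) (Free.η X)

    toWriter-η : ∀ X x → ExtMet._≈_ (Λ.space □ proj₁ X)
      (map (toWriter X) $ (Free.η X $ x)) (Λ.𝟘 , x)
    toWriter-η X = Free.extend-η {X} {writerModel X} (τ Λ (proj₁ X))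

  ℂT𝒲≅Writer : ℂT𝒲 Λ ≅ Writer Λ
  ℂT𝒲≅Writer ._≅_.to X = map (toWriter X)
  ℂT𝒲≅Writer ._≅_.from X = map (fromWriter X)
  ℂT𝒲≅Writer ._≅_.to∙from X (α , x) =
    -- Computed at every point: `(α , x)` goes to `𝗐 α` of the generator `x`, and the homomorphism
    -- `toWriter X` returns `(α * 𝟘 , x)`.
    W.≈-trans (homo (toWriter X) α (Free.η X $ x ∷ []))
      (W.≈-trans (interp-cong (writerAlgebra (proj₁ X)) α
          {map (toWriter X) $ (Free.η X $ x) ∷ []} {(Λ.𝟘 , x) ∷ []} λ { fzero → toWriter-η X x })
        (M.identityʳ α , ExtMet.≈-refl (proj₁ X)))
    where module W = ExtMet (Λ.space □ proj₁ X)
  ℂT𝒲≅Writer ._≅_.from∙to X =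
    -- The generator `x` goes to `(𝟘 , x)` and back to `𝗐 𝟘` of itself, which the zero axiom
    -- removes.
    Free.jointly-monic {X} {L} (fromWriter X ∙ toWriter X) idₘ λ x →
      L.≈-trans {map (fromWriter X) $ (map (toWriter X) $ (Free.η X $ x))}
        {map (fromWriter X) $ (Λ.𝟘 , x)} {Free.η X $ x}
        (resp-≈ (map (fromWriter X)) (toWriter-η X x))
        (interp-zero (algebra L) (models L) (Free.η X $ x))
    where
    L = Free.L₀ X
    module L = QuantAlgebra (algebra L)
  ℂT𝒲≅Writer ._≅_.natural {X} {Y} f =
    -- Both homomorphisms send the generator `x` to `(𝟘 , f $ x)`.
    Free.jointly-monic {X} {writerModel Y} (toWriter Y ∙ Free.L₁ {X} {Y} f)
      (Λ□₁-hom (proj₁ X) (proj₁ Y) f ∙ toWriter X) λ x →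
      W.≈-trans (resp-≈ (map (toWriter Y)) {map (Free.L₁ {X} {Y} f) $ (Free.η X $ x)} {Free.η Y $ (f $ x)}
          (Free.extend-η {X} {Free.L₀ Y} (Free.η Y ∘ₙ f) x))
        (W.≈-trans (toWriter-η Y (f $ x))
          (W.≈-sym (resp-≈ (Λ□₁ Λ (proj₁ X) (proj₁ Y) f) (toWriter-η X x))))
    where module W = ExtMet (Λ.space □ proj₁ Y)
  ℂT𝒲≅Writer ._≅_.to-η = toWriter-η
  ℂT𝒲≅Writer ._≅_.to-μ X =
    -- Both send the generator `t` to the image of `t` under `toWriter X`: on the left the counit
    -- returns `t`, on the right `t` becomes `(𝟘 , t)` and `ς` absorbs the `𝟘`.
    Free.jointly-monic {UL} {writerModel X} (toWriter X ∙ Free.ε L)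
      (ς-hom (proj₁ X) ∙
        (Λ□₁-hom (proj₁ UL) (Λ.space □ proj₁ X) (map (toWriter X)) ∙ toWriter UL))
      λ t →
      W.≈-trans (resp-≈ (map (toWriter X)) {map (Free.ε L) $ (Free.η UL $ t)} {t}
          (Free.extend-η {UL} {L} idₙ t))
        (W.≈-sym (W.≈-trans
          (resp-≈ (ς Λ (proj₁ X))
            (resp-≈ (Λ□₁ Λ (proj₁ UL) (Λ.space □ proj₁ X) (map (toWriter X)))
              {map (toWriter UL) $ (Free.η UL $ t)} {Λ.𝟘 , t} (toWriter-η UL t)))
          (M.identityˡ _ , ExtMet.≈-refl (proj₁ X))))
    where
    L = Free.L₀ X
    UL = Functor.F₀ (forgetful S (𝒲 Λ)) L
    module W = ExtMet (Λ.space □ proj₁ X)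

theorem4p11 : ∀ {ℓ} (Λ : CompleteMetricMonoid ℓ) → ℂT𝒲 Λ ≅ Writer Λ
theorem4p11 = ℂT𝒲≅Writer
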